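{- Let $\mathbf{K}$ be a pure simplicial complex of dimension $d$ satisfying the hereditary removal-collapsibility (HRC) condition. Then the second barycentric subdivision $\mathrm{sd}^2\,\mathbf{K}=\mathrm{sd}(\mathrm{sd}\,\mathbf{K})$ is shellable.
   Context: Simplicial complexes are finite abstract simplicial complexes: finite set systems closed under taking subsets. A face with $k+1$ elements has dimension $k$; $\emptyset$ is a face of dimension $-1$ of every complex other than the void complex. The void complex $\emptyset$ (no faces, dimension $-\infty$) is distinguished from $\{\emptyset\}$ (dimension $-1$); a complex of dimension $d$ has $d\ge -1$. A facet is an inclusion-wise maximal face; a complex is pure if all its facets have the same dimension. The link of a face $\sigma\in\mathbf{K}$ is $\mathrm{lk}(\sigma,\mathbf{K})=\{\sigma'\setminus\sigma:\ \sigma'\in\mathbf{K},\ \sigma\subseteq\sigma'\}$; in particular $\mathrm{lk}(\emptyset,\mathbf{K})=\mathbf{K}$. The barycentric subdivision is $\mathrm{sd}\,\mathbf{K}=\{\{\sigma_1,\dots,\sigma_n\}:\ n\ge 0,\ \sigma_i\in\mathbf{K},\ \emptyset\ne\sigma_1\subsetneq\cdots\subsetneq\sigma_n\}$. Collapsibility: if a nonempty face $\sigma\in\mathbf{K}$ is properly contained in exactly one face $\tau$ of $\mathbf{K}$, then $\mathbf{K}\setminus\{\sigma,\tau\}$ arises from $\mathbf{K}$ by an elementary collapse. $\mathbf{K}$ is collapsible if some (possibly empty) sequence of elementary collapses reduces it to a point (a complex $\{\emptyset,\{v\}\}$). (RC) condition: a pure complex $\mathbf{K}$ satisfies the removal-collapsibility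 condition (RC) if either $\mathbf{K}$ is empty (meaning it has no vertices, i.e. $\mathbf{K}=\emptyset$ or $\mathbf{K}=\{\emptyset\}$), or there is a (possibly empty) set of facets $\phi_1,\dots,\phi_t$ of $\mathbf{K}$ such that $\mathbf{K}\setminus\{\phi_1,\dots,\phi_t\}$ (only the faces $\phi_i$ themselves are deleted) is collapsible. (HRC) condition: a pure complex $\mathbf{K}$ satisfies the hereditary removal-collapsibility condition (HRC) if $\mathrm{lk}(\sigma,\mathbf{K})$ satisfies (RC) for every face $\sigma\in\mathbf{K}$, including $\sigma=\emptyset$. Shellability: a pure complex of dimension $k$ is shellable if its facets admit a total order $F_1,\dots,F_t$ such that for every $i\ge 2$ the complex $F_i\cap\bigcup_{j=1}^{i-1}F_j$ is pure of dimension $k-1$, where each facet is regarded as the subcomplex of all its subsets. -}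

module Defs where

open import Data.Empty using () renaming (⊥ to False)
open import Data.Fin using (Fin; toℕ; funToFin; finToFun)
open import Data.Fin.Properties using (2↔Bool; finToFun-funToFin)
open import Data.Fin.Subset
open import Data.Fin.Subset.Properties
import Data.Integer as ℤ
open import Data.Integer using (ℤ; 1ℤ)
open import Data.List using (List; []; _∷_; map; foldr; filter; length; lookup; take)
open import Data.List.Membership.Propositional using () renaming (_∈_ to _∈ₗ_; _∉_ to _∉ₗ_)
open import Data.List.Membership.Propositional.Properties using (∈-filter⁺; ∈-filter⁻)
open import Data.List.Relation.Unary.All as All using (All; []; _∷_)
import Data.List.Relation.Unary.All.Properties as All
open import Data.List.Relation.Unary.Any using (here; there)
open import Data.List.Relation.Unary.Linked as Linked using (Linked; []; [-]; _∷_)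
import Data.List.Relation.Unary.Linked.Properties as Linked
open import Data.List.Relation.Unary.Unique.Propositional using (Unique)
open import Data.Nat using (ℕ; zero; suc; _+_; _^_; _≤_; _<_; z≤n; s≤s)
import Data.Nat.Properties as ℕ
open import Data.Bool.Properties using () renaming (_≟_ to _≟ᵇ_)
open import Data.Product using (∃; ∃-syntax; _×_; _,_; proj₂)
open import Data.Sum as Sum using (_⊎_; inj₁; inj₂)
open import Data.Vec using (_∷_; there; tabulate) renaming (lookup to lookupᵥ)
open import Data.Vec.Properties using (≡-dec; tabulate∘lookup; tabulate-cong)
open import Function using (_∘_; _⇔_; Inverse; Injective)
open import Relation.Binary.Construct.Closure.ReflexiveTransitive using (Star)
open import Relation.Binary.PropositionalEquality
  using (_≡_; refl; sym; trans; cong; subst)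
open import Relation.Nullary using (¬_; Dec; yes; no; contradiction)
open import Relation.Nullary.Decidable using (map′; _×-dec_; _⊎-dec_)
open import Relation.Unary using (Pred; Decidable) renaming (_≐_ to _≐ᵖ_)

private variable
  m n : ℕ

_≟ˢ_ : (p q : Subset n) → Dec (p ≡ q)
_≟ˢ_ = ≡-dec _≟ᵇ_

-- Not every i : Fin n need be a vertex: i is a vertex iff ⁅ i ⁆ is a face.
-- The void complex (no faces at all) is allowed.
record Complex (n : ℕ) : Set₁ where
  field
    Face     : Pred (Subset n) _
    face?    : Decidable Face
    ⊆-closed : ∀ {σ τ} → σ ⊆ τ → Face τ → Face σ

open Complex public

dim : Subset n → ℤ
dim σ = ℤ.+ ∣ σ ∣ ℤ.- 1ℤ

-- The void complex has no dimension in this sense.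
HasDimension : Complex n → ℤ → Set
HasDimension K d =
  (∃[ σ ] Face K σ × dim σ ≡ d) × (∀ σ → Face K σ → dim σ ℤ.≤ d)

Facet : Complex n → Subset n → Set
Facet K σ = Face K σ × (∀ τ → Face K τ → σ ⊆ τ → σ ≡ τ)

Pure : Complex n → Set
Pure K = ∀ σ τ → Facet K σ → Facet K τ → dim σ ≡ dim τ

-- Meaningful for σ ∈ K; otherwise the result is void.
lk : Subset n → Complex n → Complex n
lk {n} σ K = record
  { Face     = λ ρ → ∃[ σ′ ] Face K σ′ × σ ⊆ σ′ × ρ ≡ σ′ ─ σ
  ; face?    = λ ρ → anySubset? λ σ′ → face? K σ′ ×-dec σ ⊆? σ′ ×-dec ρ ≟ˢ (σ′ ─ σ)
  ; ⊆-closed = closed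
  }
  where
  x∈p─q⇒x∉q : ∀ {k} {x : Fin k} (p q : Subset k) → x ∈ p ─ q → x ∉ q
  x∈p─q⇒x∉q (_ ∷ p) (_ ∷ q) (there x∈) (there x∈q) = x∈p─q⇒x∉q p q x∈ x∈q

  closed : ∀ {ρ ρ′} → ρ ⊆ ρ′ →
           (∃[ σ′ ] Face K σ′ × σ ⊆ σ′ × ρ′ ≡ σ′ ─ σ) →
           ∃[ σ′ ] Face K σ′ × σ ⊆ σ′ × ρ ≡ σ′ ─ σ
  closed {ρ} ρ⊆ (σ′ , σ′∈K , σ⊆σ′ , refl) =
    σ ∪ ρ , ⊆-closed K into σ′∈K , p⊆p∪q ρ , ⊆-antisym fwd bwd
    where
    into : σ ∪ ρ ⊆ σ′
    into x∈ with x∈p∪q⁻ σ ρ x∈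
    ... | inj₁ x∈σ = σ⊆σ′ x∈σ
    ... | inj₂ x∈ρ = p─q⊆p σ′ σ (ρ⊆ x∈ρ)

    fwd : ρ ⊆ (σ ∪ ρ) ─ σ
    fwd x∈ρ = x∈p∧x∉q⇒x∈p─q (q⊆p∪q σ ρ x∈ρ) (x∈p─q⇒x∉q σ′ σ (ρ⊆ x∈ρ))

    bwd : (σ ∪ ρ) ─ σ ⊆ ρ
    bwd x∈ with x∈p∪q⁻ σ ρ (p─q⊆p (σ ∪ ρ) σ x∈)
    ... | inj₁ x∈σ = contradiction x∈σ (x∈p─q⇒x∉q (σ ∪ ρ) σ x∈)
    ... | inj₂ x∈ρ = x∈ρ

-- A vertex of sd K is a face of K, i.e. a Subset n; to stay within complexes on
-- an initial segment of ℕ these are numbered by Fin (2 ^ n).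
code : Subset n → Fin (2 ^ n)
code σ = funToFin (Inverse.from 2↔Bool ∘ lookupᵥ σ)

code-injective : Injective _≡_ _≡_ (code {n})
code-injective {n} {p} {q} eq =
  trans (sym (decode-code p)) (trans (cong decode eq) (decode-code q))
  where
  decode : Fin (2 ^ n) → Subset n
  decode x = tabulate (Inverse.to 2↔Bool ∘ finToFun {2} {n} x)

  decode-code : ∀ σ → decode (code σ) ≡ σ
  decode-code σ = trans
    (tabulate-cong λ i → trans
      (cong (Inverse.to 2↔Bool) (finToFun-funToFin (Inverse.from 2↔Bool ∘ lookupᵥ σ) i))
      (Inverse.strictlyInverseˡ 2↔Bool (lookupᵥ σ i)))
    (tabulate∘lookup σ)

IsChain : Complex n → List (Subset n) → Set
IsChain K σs = All (λ σ → Face K σ × Nonempty σ) σs × Linked _⊂_ σs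

codes : List (Subset n) → Subset (2 ^ n)
codes σs = ⋃ (map (⁅_⁆ ∘ code) σs)

∈-codes⁺ : ∀ {σ : Subset n} {σs} → σ ∈ₗ σs → code σ ∈ codes σs
∈-codes⁺ {σs = τ ∷ σs} (here refl) = x∈p∪q⁺ {q = codes σs} (inj₁ (x∈⁅x⁆ (code τ)))
∈-codes⁺ {σs = τ ∷ σs} (there σ∈)  = x∈p∪q⁺ {p = ⁅ code τ ⁆} (inj₂ (∈-codes⁺ σ∈))

∈-codes⁻ : ∀ (σs : List (Subset n)) {x} → x ∈ codes σs → ∃[ σ ] σ ∈ₗ σs × x ≡ code σ
∈-codes⁻ []       x∈ = contradiction x∈ ∉⊥
∈-codes⁻ (τ ∷ σs) x∈ with x∈p∪q⁻ ⁅ code τ ⁆ (codes σs) x∈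
... | inj₁ x∈⁅τ⁆ = τ , here refl , x∈⁅y⁆⇒x≡y _ x∈⁅τ⁆
... | inj₂ x∈σs  = let σ , σ∈ , eq = ∈-codes⁻ σs x∈σs in σ , there σ∈ , eq

private
  ⊂-length : ∀ {σ : Subset n} {σs} → Linked _⊂_ (σ ∷ σs) → ∣ σ ∣ + length σs ≤ n
  ⊂-length {σ = σ} [-] = subst (_≤ _) (sym (ℕ.+-identityʳ ∣ σ ∣)) (∣p∣≤n σ)
  ⊂-length {σ = σ} {τ ∷ σs} (σ⊂τ ∷ l) = ℕ.≤-trans
    (ℕ.≤-trans (ℕ.≤-reflexive (ℕ.+-suc ∣ σ ∣ (length σs)))
               (ℕ.+-monoˡ-≤ (length σs) (p⊂q⇒∣p∣<∣q∣ σ⊂τ)))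
    (⊂-length l)

  chain-length : ∀ {σs : List (Subset n)} → Linked _⊂_ σs → length σs ≤ suc n
  chain-length {σs = []}     _ = z≤n
  chain-length {σs = σ ∷ σs} l =
    s≤s (ℕ.≤-trans (ℕ.m≤n+m (length σs) ∣ σ ∣) (⊂-length l))

  anyList? : ∀ k {P : List (Subset n) → Set} → Decidable P →
             Dec (∃[ σs ] length σs ≤ k × P σs)
  anyList? zero P? = map′ (λ p → [] , z≤n , p) (λ { ([] , _ , p) → p }) (P? [])
  anyList? (suc k) {P} P? = map′ to from
    (P? [] ⊎-dec anySubset? λ σ → anyList? k (P? ∘ (σ ∷_)))
    where
    to : P [] ⊎ (∃[ σ ] ∃[ σs ] length σs ≤ k × P (σ ∷ σs)) →
         ∃[ σs ] length σs ≤ suc k × P σs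
    to (inj₁ p)                 = [] , z≤n , p
    to (inj₂ (σ , σs , l , p)) = σ ∷ σs , s≤s l , p

    from : (∃[ σs ] length σs ≤ suc k × P σs) →
           P [] ⊎ (∃[ σ ] ∃[ σs ] length σs ≤ k × P (σ ∷ σs))
    from ([] , _ , p)           = inj₁ p
    from (σ ∷ σs , s≤s l , p) = inj₂ (σ , σs , l , p)

  isChain? : (K : Complex n) → Decidable (IsChain K)
  isChain? K σs =
    All.all? (λ σ → face? K σ ×-dec nonempty? σ) σs ×-dec Linked.linked? _⊂?_ σs

sd : Complex n → Complex (2 ^ n)
sd {n} K = record
  { Face     = λ S → ∃[ σs ] IsChain K σs × S ≡ codes σs
  ; face?    = λ S → map′
      (λ (σs , _ , p) → σs , p)
      (λ (σs , c , eq) → σs , chain-length (proj₂ c) , c , eq)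
      (anyList? (suc n) λ σs → isChain? K σs ×-dec S ≟ˢ codes σs)
  ; ⊆-closed = closed
  }
  where
  closed : ∀ {S T} → S ⊆ T →
           (∃[ σs ] IsChain K σs × T ≡ codes σs) → ∃[ σs ] IsChain K σs × S ≡ codes σs
  closed {S} S⊆T (σs , (faces , linked) , refl) =
    filter inS? σs
    , (All.filter⁺ inS? faces , Linked.filter⁺ inS? ⊂-trans linked)
    , ⊆-antisym fwd bwd
    where
    inS? : Decidable (λ σ → code σ ∈ S)
    inS? σ = code σ ∈? S

    fwd : S ⊆ codes (filter inS? σs)
    fwd x∈S with ∈-codes⁻ σs (S⊆T x∈S)
    ... | σ , σ∈ , refl = ∈-codes⁺ (∈-filter⁺ inS? σ∈ x∈S)

    bwd : codes (filter inS? σs) ⊆ S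
    bwd x∈ with ∈-codes⁻ (filter inS? σs) x∈
    ... | σ , σ∈ , refl = proj₂ (∈-filter⁻ inS? {xs = σs} σ∈)

-- L ≐ K ∖ σs: the complex L is K with exactly the faces listed in σs deleted.
infix 4 _≐_∖_
_≐_∖_ : Complex n → Complex n → List (Subset n) → Set
L ≐ K ∖ σs = Face L ≐ᵖ λ ρ → Face K ρ × ρ ∉ₗ σs

infix 4 _↘_
record _↘_ (K L : Complex n) : Set where
  field
    {σ τ}    : Subset n
    σ∈K      : Face K σ
    nonempty : Nonempty σ
    τ∈K      : Face K τ
    σ⊂τ      : σ ⊂ τ
    unique   : ∀ ρ → Face K ρ → σ ⊂ ρ → ρ ≡ τ
    result   : L ≐ K ∖ (σ ∷ τ ∷ [])

IsPoint : Complex n → Set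
IsPoint K = ∃[ v ] Face K ≐ᵖ (_∈ₗ ⊥ ∷ ⁅ v ⁆ ∷ [])

Collapsible : Complex n → Set₁
Collapsible K = ∃[ L ] Star _↘_ K L × IsPoint L

NoVertices : Complex n → Set
NoVertices K = ∀ v → ¬ Face K ⁅ v ⁆

-- RC and HRC are conditions on pure complexes; purity is assumed separately.
RC : Complex n → Set₁
RC K = NoVertices K ⊎
  (∃[ φs ] All (Facet K) φs × ∃[ L ] L ≐ K ∖ φs × Collapsible L)

HRC : Complex n → Set₁
HRC K = ∀ σ → Face K σ → RC (lk σ K)

⟪_⟫ : Subset n → Complex n
⟪ F ⟫ = record
  { Face     = _⊆ F
  ; face?    = _⊆? F
  ; ⊆-closed = ⊆-trans
  }

voidᶜ : Complex n
voidᶜ = record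
  { Face     = λ _ → False
  ; face?    = λ _ → no λ ()
  ; ⊆-closed = λ _ ()
  }

infixr 7 _∩ᶜ_
infixr 6 _∪ᶜ_

_∩ᶜ_ _∪ᶜ_ : Complex n → Complex n → Complex n
K ∩ᶜ L = record
  { Face     = λ ρ → Face K ρ × Face L ρ
  ; face?    = λ ρ → face? K ρ ×-dec face? L ρ
  ; ⊆-closed = λ ρ⊆ (k , l) → ⊆-closed K ρ⊆ k , ⊆-closed L ρ⊆ l
  }
K ∪ᶜ L = record
  { Face     = λ ρ → Face K ρ ⊎ Face L ρ
  ; face?    = λ ρ → face? K ρ ⊎-dec face? L ρ
  ; ⊆-closed = λ ρ⊆ → Sum.map (⊆-closed K ρ⊆) (⊆-closed L ρ⊆)
  }

⋃ᶜ : List (Complex n) → Complex n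
⋃ᶜ = foldr _∪ᶜ_ voidᶜ

-- Indices start at 0, so the condition 2 ≤ i on F₁, …, Fₜ becomes 0 < toℕ i, and
-- take (toℕ i) Fs lists the facets preceding lookup Fs i.
record IsShelling (K : Complex n) (k : ℤ) (Fs : List (Subset n)) : Set where
  field
    distinct : Unique Fs
    facets   : ∀ F → F ∈ₗ Fs ⇔ Facet K F
    shelling : ∀ (i : Fin (length Fs)) → 0 < toℕ i →
               let L = ⟪ lookup Fs i ⟫ ∩ᶜ ⋃ᶜ (map ⟪_⟫ (take (toℕ i) Fs))
               in Pure L × HasDimension L (k ℤ.- 1ℤ)

Shellable : Complex n → Set
Shellable K = Pure K × ∃[ k ] HasDimension K k × ∃[ Fs ] IsShelling K k Fs

{-# OPTIONS --safe #-}

-- sd K is the clique complex of the comparability graph on the nonempty faces of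
-- K, and the facets of sd(sd K) are the words that list a maximal clique in some
-- order. Call a vertex order good if the link of every vertex b has a good order
-- that starts with the neighbours of b preceding b, and if such neighbours exist
-- unless b is first or its link is empty; this is a recursive atom ordering of
-- the face poset of sd K, and the lexicographic order of the words is then a
-- shelling.
--
-- A good order is produced from the collapses. Reversing the collapse of lk(σ, K)
-- minus some facets, insert for each pair s ⊂ t first t, then s, and finally the
-- removed facets. The link of a face τ is the join of the open interval (σ, τ)
-- with the faces above τ. When t is inserted, all of (σ, t) but s is present,
-- which is the boundary of a simplex minus a facet; when s is inserted, all of
-- (σ, s) is present, and t as the only face above s. So the part of the link that
-- is already there is again collapsible-like, and an order for the join can be
-- glued from orders of the two factors. The collapse can be rerooted at any
-- vertex, so that the order on the faces above s may be taken to start with t.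

module Submission where

open import Defs hiding (_≐_∖_)
open import Level using (0ℓ)
open import Data.Empty using (⊥; ⊥-elim)
open import Data.Unit using (⊤; tt)
open import Data.Fin as Fin using (Fin; toℕ)
open import Data.Fin.Subset using (Subset; inside; outside; _⊂_; _─_; _-_; ⁅_⁆; ∣_∣; Nonempty)
  renaming (_∈_ to _∈ˢ_; _∉_ to _∉ˢ_; _⊆_ to _⊆ˢ_; _∪_ to _∪ˢ_; _∩_ to _∩ˢ_; ⊥ to ⊥ˢ)
open import Data.Fin.Subset.Properties
  using (⊂-trans; ⊂-irref; ⊂-⊆-trans; anySubset?; ⊆-⊂-trans; p⊂q⇒p⊆q; p⊂q⇒∣p∣<∣q∣; p⊆q⇒∣p∣≤∣q∣; ⊆-antisym; ⊆-refl; ⊆-trans;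
         _⊂?_; p⊆p∪q; q⊆p∪q; x∈p∪q⁻; x∈p∪q⁺; x∈⁅x⁆; x∈⁅y⁆⇒x≡y; p─q⊆p; x∈p∧x∉q⇒x∈p─q; x∈p∧x≢y⇒x∈p-y;
         drop-∷-⊆; ∣⊥∣≡0; ⊥⊆; ∉⊥; ∪-identityʳ; x∈p∩q⁺; x∈p∩q⁻; p∩q⊆p; p∩q⊆q)
  renaming (_∈?_ to _∈ˢ?_; ∪-assoc to ∪-assocˢ; ∪-comm to ∪-commˢ)
import Data.Integer as ℤ
import Data.Integer.Properties as ℤ
open import Data.Integer using (ℤ)
open import Data.List using (List; []; _∷_; _++_; map; length; take; filter; reverse; applyUpTo; lookup)
open import Data.List.Membership.Propositional using (_∈_; _∉_)
import Data.List.Membership.DecPropositional as DecMembership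
open import Data.List.Membership.Propositional.Properties
  using (∈-++⁺ˡ; ∈-++⁺ʳ; ∈-++⁻; ∈-map⁺; ∈-map⁻; ∈-filter⁺; ∈-filter⁻; ∈-applyUpTo⁺; ∈-applyUpTo⁻)
open import Data.List.Properties using (++-assoc; ++-identityʳ; length-applyUpTo; length-take; unfold-reverse; length-++)
open import Data.List.Relation.Unary.All as All using (All; []; _∷_)
import Data.List.Relation.Unary.All.Properties as All
open import Data.List.Relation.Unary.AllPairs as AllPairs using (AllPairs; []; _∷_)
import Data.List.Relation.Unary.AllPairs.Properties as AllPairs
open import Data.List.Relation.Unary.Any using (here; there)
import Data.List.Relation.Unary.Any.Properties as Any
open import Data.List.Relation.Unary.Linked as Linked using (Linked; []; _∷_)
import Data.List.Relation.Unary.Linked.Properties as Linked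
open import Data.List.Relation.Unary.Unique.Propositional using (Unique)
open import Data.Nat using (ℕ; zero; suc; _+_; _^_; _≤_; _<_; z≤n; s≤s; s≤s⁻¹)
import Data.Nat.Properties as ℕ
open import Data.Nat.Properties using (+-identityʳ; +-suc; +-comm; suc-injective)
open import Data.Product using (∃-syntax; Σ-syntax; _×_; _,_; proj₁; proj₂)
open import Data.Sum as Sum using (_⊎_; inj₁; inj₂)
open import Data.Vec using (_∷_; [])
import Data.Vec as Vec
open import Function using (id; _∘_; mk⇔)
open import Relation.Binary.Construct.Closure.ReflexiveTransitive using (Star; ε; _◅_)
open import Relation.Binary.Definitions using (DecidableEquality)
open import Relation.Binary.PropositionalEquality using (_≡_; _≢_; refl; sym; trans; cong; subst)
open import Relation.Nullary using (¬_; Dec; yes; no)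
open import Relation.Nullary.Decidable using (¬?; _×-dec_; _⊎-dec_)
open import Relation.Unary using (Pred; Decidable; _⊆_; _≐_; _∪_; _∩_; ∅; ｛_｝; Empty; Satisfiable)

-- A recursive atom ordering has to connect each vertex `b` to the earlier ones. If an earlier
-- vertex shares a clique with `b`, the edge between the two does this. For the remaining pairs one
-- earlier neighbour of `b` is enough, which is why `Connected` asks for no more.
--
-- The obstacle is the join. Two isolated points are an admissible initial segment in rank 1, where
-- links are empty. In the join with a factor of positive rank, none of which is present yet, the
-- second point has a nonempty link but no present neighbour. The situation cannot be avoided: when
-- `t` is inserted, nothing above it is present. This is why `Tame` stands beside `Good` and has no
-- instance in rank 0. In a tame segment every vertex after the first is attached along a piece that
-- is nonempty at every depth, and this survives a join with an empty initial segment. The removed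
-- facets come last and are attached along whole spheres. Those steps are good without being tame,
-- which suffices because nothing lies above such a facet.

-- Good and tame vertex orders, and their joins

module Orderings {V : Set} (_~_ : V → V → Set)
  (~-sym : ∀ {x y} → x ~ y → y ~ x) (~-irrefl : ∀ {x} → ¬ x ~ x) where

  Set′ : Set₁
  Set′ = Pred V 0ℓ

  N : V → Set′
  N b x = x ~ b

  Steps : (Set′ → V → Set) → Set′ → List V → Set
  Steps P E []      = ⊤
  Steps P E (b ∷ l) = P E b × Steps P (E ∪ ｛ b ｝) l

  Connected : ℕ → Set′ → V → Set
  Connected d E b = Empty E ⊎ d ≡ 0 ⊎ ∃[ x ] E x × x ~ b

  -- S carries a recursive atom ordering, for cliques of size d, with W as an
  -- initial segment.
  Good : ℕ → Set′ → Set′ → Set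
  Good zero    W S = Empty S × Empty W
  Good (suc d) W S =
    ∃[ l₁ ] ∃[ l₂ ] W ≐ (_∈ l₁) × S ≐ (_∈ l₁ ++ l₂) × Satisfiable S ×
    Steps (λ E b → ¬ E b × Connected d E b × Good d (E ∩ N b) (S ∩ N b)) ∅ (l₁ ++ l₂)

  GoodStep : ℕ → Set′ → Set′ → V → Set
  GoodStep d S E b = ¬ E b × Connected d E b × Good d (E ∩ N b) (S ∩ N b)

  -- In addition W is built up like a contractible complex: every vertex of it
  -- but the first is attached along a piece of its link that is again tame.
  Tame : ℕ → Set′ → Set′ → Set
  Tame zero    W S = ⊥
  Tame (suc d) W S =
    ∃[ a ] ∃[ l₁ ] ∃[ l₂ ] W ≐ (_∈ a ∷ l₁) × S ≐ (_∈ a ∷ l₁ ++ l₂) ×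
    Good d ∅ (S ∩ N a) ×
    Steps (λ E b → ¬ E b × Tame d (E ∩ N b) (S ∩ N b)) ｛ a ｝ l₁ ×
    Steps (GoodStep d S) (_∈ a ∷ l₁) l₂

  TameStep : ℕ → Set′ → Set′ → V → Set
  TameStep d S E b = ¬ E b × Tame d (E ∩ N b) (S ∩ N b)

  ≐-sym : ∀ {A B : Set′} → A ≐ B → B ≐ A
  ≐-sym (f , g) = g , f

  ≐-trans : ∀ {A B C : Set′} → A ≐ B → B ≐ C → A ≐ C
  ≐-trans (f , g) (f′ , g′) = f′ ∘ f , g ∘ g′

  ≐-refl : ∀ {A : Set′} → A ≐ A
  ≐-refl = id , id

  ∪-cong : ∀ {A A′ B B′ : Set′} → A ≐ A′ → B ≐ B′ → (A ∪ B) ≐ (A′ ∪ B′)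
  ∪-cong (f , g) (f′ , g′) =
    (λ { (inj₁ a) → inj₁ (f a) ; (inj₂ b) → inj₂ (f′ b) }) ,
    (λ { (inj₁ a) → inj₁ (g a) ; (inj₂ b) → inj₂ (g′ b) })

  ∩-congˡ : ∀ {A A′ B : Set′} → A ≐ A′ → (A ∩ B) ≐ (A′ ∩ B)
  ∩-congˡ (f , g) = (λ (a , b) → f a , b) , (λ (a , b) → g a , b)

  ∪-comm : ∀ {A B : Set′} → (A ∪ B) ≐ (B ∪ A)
  ∪-comm = (λ { (inj₁ a) → inj₂ a ; (inj₂ b) → inj₁ b }) ,
           (λ { (inj₁ a) → inj₂ a ; (inj₂ b) → inj₁ b })

  ∪-∅ : ∀ {A : Set′} → (A ∪ ∅) ≐ A
  ∪-∅ = (λ { (inj₁ a) → a }) , inj₁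

  ∅-∪ : ∀ {A : Set′} → (∅ ∪ A) ≐ A
  ∅-∪ = ≐-trans ∪-comm ∪-∅

  ∪-swap : ∀ {A B C : Set′} → ((A ∪ B) ∪ C) ≐ ((A ∪ C) ∪ B)
  ∪-swap = (λ { (inj₁ (inj₁ a)) → inj₁ (inj₁ a) ; (inj₁ (inj₂ b)) → inj₂ b ; (inj₂ c) → inj₁ (inj₂ c) }) ,
           (λ { (inj₁ (inj₁ a)) → inj₁ (inj₁ a) ; (inj₁ (inj₂ b)) → inj₂ b ; (inj₂ c) → inj₁ (inj₂ c) })

  ∷-≐ : ∀ {b : V} {l} → (_∈ b ∷ l) ≐ (｛ b ｝ ∪ (_∈ l))
  ∷-≐ = (λ { (here refl) → inj₁ refl ; (there p) → inj₂ p }) ,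
        (λ { (inj₁ refl) → here refl ; (inj₂ p) → there p })

  ++-≐ : ∀ (l : List V) {m} → (_∈ l ++ m) ≐ ((_∈ l) ∪ (_∈ m))
  ++-≐ l = ∈-++⁻ l , (λ { (inj₁ p) → ∈-++⁺ˡ p ; (inj₂ p) → ∈-++⁺ʳ l p })

  Respects≐ : (Set′ → V → Set) → Set₁
  Respects≐ P = ∀ {E E′ b} → E ≐ E′ → P E b → P E′ b

  -- Stages are predicates that agree only up to `≐`, so the case `C = ∅` already does work: it
  -- exchanges a stage for an equivalent one. A nonempty `C` is the part of the other factor of a
  -- join that is present throughout.
  map-steps : ∀ {P Q : Set′ → V → Set} C {E E′} l → E′ ≐ (E ∪ C) →
    (∀ {E E′ b} → b ∈ l → E′ ≐ (E ∪ C) → P E b → Q E′ b) → Steps P E l → Steps Q E′ l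
  map-steps C []      eq f _        = tt
  map-steps C (b ∷ l) eq f (p , ps) =
    f (here refl) eq p ,
    map-steps C l (≐-trans (∪-cong eq ≐-refl) ∪-swap) (f ∘ there) ps

  steps-resp : ∀ {P : Set′ → V → Set} {E E′} l → Respects≐ P → E ≐ E′ → Steps P E l → Steps P E′ l
  steps-resp l r eq = map-steps ∅ l (≐-trans (≐-sym eq) (≐-sym ∪-∅))
    λ _ eq′ → r (≐-sym (≐-trans eq′ ∪-∅))

  private
    ∪-∷ : ∀ {E : Set′} {b l} → (E ∪ (_∈ b ∷ l)) ≐ ((E ∪ ｛ b ｝) ∪ (_∈ l))
    ∪-∷ =
      (λ { (inj₁ e) → inj₁ (inj₁ e) ; (inj₂ (here refl)) → inj₁ (inj₂ refl) ; (inj₂ (there p)) → inj₂ p }) ,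
      (λ { (inj₁ (inj₁ e)) → inj₁ e ; (inj₁ (inj₂ refl)) → inj₂ (here refl) ; (inj₂ p) → inj₂ (there p) })

  steps-++ : ∀ {P : Set′ → V → Set} {E E′} l {m} → Respects≐ P → E′ ≐ (E ∪ (_∈ l)) →
    Steps P E l → Steps P E′ m → Steps P E (l ++ m)
  steps-++ [] r eq _ qs = steps-resp _ r (≐-trans eq ((λ { (inj₁ e) → e ; (inj₂ ()) }) , inj₁)) qs
  steps-++ (b ∷ l) r eq (p , ps) qs = p , steps-++ l r (≐-trans eq ∪-∷) ps qs

  steps-++⁻ : ∀ {P : Set′ → V → Set} {E} l {m} → Respects≐ P →
    Steps P E (l ++ m) → Steps P E l × Steps P (E ∪ (_∈ l)) m
  steps-++⁻ [] r qs = tt , steps-resp _ r (inj₁ , (λ { (inj₁ e) → e ; (inj₂ ()) })) qs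
  steps-++⁻ (b ∷ l) r (p , ps) =
    let ps₁ , ps₂ = steps-++⁻ l r ps in (p , ps₁) , steps-resp _ r (≐-sym ∪-∷) ps₂

  connected-resp : ∀ {d E E′ b} → E ≐ E′ → Connected d E b → Connected d E′ b
  connected-resp (f , g) (inj₁ e)                  = inj₁ λ x → e x ∘ g
  connected-resp eq (inj₂ (inj₁ z))                = inj₂ (inj₁ z)
  connected-resp (f , g) (inj₂ (inj₂ (x , e , a))) = inj₂ (inj₂ (x , f e , a))

  good-resp : ∀ d {W W′ S S′} → W ≐ W′ → S ≐ S′ → Good d W S → Good d W′ S′
  good-resp zero (_ , g) (_ , g′) (e , e′) = (λ x → e x ∘ g′) , (λ x → e′ x ∘ g)
  good-resp (suc d) w s (l₁ , l₂ , w′ , s′ , (x , x∈) , st) =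
    l₁ , l₂ , ≐-trans (≐-sym w) w′ , ≐-trans (≐-sym s) s′ , (x , proj₁ s x∈) ,
    map-steps ∅ (l₁ ++ l₂) (≐-sym ∪-∅)
      (λ _ eq (ne , co , g) → let eq′ = ≐-trans eq ∪-∅ in
        ne ∘ proj₁ eq′ , connected-resp (≐-sym eq′) co , good-resp d (∩-congˡ (≐-sym eq′)) (∩-congˡ s) g)
      st

  goodStep-resp : ∀ d {S} → Respects≐ (GoodStep d S)
  goodStep-resp d eq (ne , co , g) =
    ne ∘ proj₂ eq , connected-resp eq co , good-resp d (∩-congˡ eq) ≐-refl g

  private
    goodSteps-resp : ∀ d {S S′ E E′} l → S ≐ S′ → E ≐ E′ → Steps (GoodStep d S) E l → Steps (GoodStep d S′) E′ l
    goodSteps-resp d l s e = map-steps ∅ l (≐-trans (≐-sym e) (≐-sym ∪-∅))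
      λ _ eq (ne , co , g) → let eq′ = ≐-trans eq ∪-∅ in
        ne ∘ proj₁ eq′ , connected-resp (≐-sym eq′) co , good-resp d (∩-congˡ (≐-sym eq′)) (∩-congˡ s) g

  tame-resp : ∀ d {W W′ S S′} → W ≐ W′ → S ≐ S′ → Tame d W S → Tame d W′ S′
  tame-resp (suc d) w s (a , l₁ , l₂ , w′ , s′ , g , st₁ , st₂) =
    a , l₁ , l₂ , ≐-trans (≐-sym w) w′ , ≐-trans (≐-sym s) s′ , good-resp d ≐-refl (∩-congˡ s) g ,
    map-steps ∅ l₁ (≐-sym ∪-∅)
      (λ _ eq (ne , t) → let eq′ = ≐-trans eq ∪-∅ in
        ne ∘ proj₁ eq′ , tame-resp d (∩-congˡ (≐-sym eq′)) (∩-congˡ s) t) st₁ ,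
    goodSteps-resp d l₂ s ≐-refl st₂

  tameStep-resp : ∀ d {S} → Respects≐ (TameStep d S)
  tameStep-resp d eq (ne , t) = ne ∘ proj₂ eq , tame-resp d (∩-congˡ eq) ≐-refl t

  tame⇒satisfiable : ∀ d {W S} → Tame d W S → Satisfiable W
  tame⇒satisfiable (suc d) (a , _ , _ , w , _) = a , proj₂ w (here refl)

  tame⇒good : ∀ d {W S} → Tame d W S → Good d W S
  -- A tame piece of the link is nonempty, and any of its members is the neighbour that `Connected`
  -- asks for.
  tameStep⇒goodStep : ∀ d {S E b} → TameStep d S E b → GoodStep d S E b

  tame⇒good (suc d) (a , l₁ , l₂ , w , s , g , st₁ , st₂) =
    a ∷ l₁ , l₂ , w , s , (a , proj₂ s (here refl)) ,
    ((λ ()) , inj₁ (λ _ ()) , good-resp d ((λ ()) , λ ()) ≐-refl g) ,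
    steps-++ l₁ (goodStep-resp d) (≐-trans ∷-≐ (∪-cong (≐-sym ∅-∪) ≐-refl))
      (map-steps ∅ l₁ (≐-trans ∅-∪ (≐-sym ∪-∅))
        (λ _ eq → goodStep-resp d (≐-sym (≐-trans eq ∪-∅)) ∘ tameStep⇒goodStep d) st₁)
      st₂

  tameStep⇒goodStep d (ne , t) =
    ne , inj₂ (inj₂ (tame⇒satisfiable d t)) , tame⇒good d t

  good⇒⊆ : ∀ d {W S} → Good d W S → W ⊆ S
  good⇒⊆ zero    (_ , e)              = λ w → ⊥-elim (e _ w)
  good⇒⊆ (suc d) (l₁ , l₂ , w , s , _) = proj₂ s ∘ ∈-++⁺ˡ ∘ proj₁ w

  -- `W` only marks how much of the list counts as initial, so the same list serves for a shorter or
  -- longer prefix.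
  good-∅ : ∀ d {W S} → Good d W S → Good d ∅ S
  good-∅ zero    (e , _) = e , λ _ ()
  good-∅ (suc d) (l₁ , l₂ , w , s , n , st) = [] , l₁ ++ l₂ , ((λ ()) , λ ()) , s , n , st

  good-all : ∀ d {W S} → Good d W S → Good d S S
  good-all zero    (e , _) = e , e
  good-all (suc d) (l₁ , l₂ , w , s , n , st) =
    l₁ ++ l₂ , [] , s , ≐-trans s (∈-++⁺ˡ , λ p → un p) , n ,
    steps-++ (l₁ ++ l₂) (goodStep-resp d) ≐-refl st tt
    where
    un : ∀ {l} {x : V} → x ∈ l ++ [] → x ∈ l
    un {l} p with ∈-++⁻ l p
    ... | inj₁ q = q

  -- If the initial segment is cut down to its first vertex, no tame step is left to check.
  good⇒tame : ∀ d {W S} → Good (suc d) W S → Satisfiable W → ∃[ a ] W a × Tame (suc d) ｛ a ｝ S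
  good⇒tame d ([] , l₂ , w , _) (x , wx) with () ← proj₁ w wx
  good⇒tame d (a ∷ l₁ , l₂ , w , s , n , (_ , _ , g) , st) _ = a , proj₂ w (here refl) ,
    (a , [] , l₁ ++ l₂ , ((λ { refl → here refl }) , λ { (here refl) → refl }) , s ,
     good-∅ d g , tt , steps-resp (l₁ ++ l₂) (goodStep-resp d)
       ((λ { (inj₂ refl) → here refl }) , λ { (here refl) → inj₂ refl }) st)

  good⇒tame-∅ : ∀ d {W S} → Good (suc d) W S → ∃[ a ] Tame (suc d) ｛ a ｝ S
  good⇒tame-∅ d g =
    let a , _ , t = good⇒tame d (good-all (suc d) g) (proj₁ (proj₂ (proj₂ (proj₂ (proj₂ g))))) in a , t

  good-satisfiable : ∀ d {W S} → Good d W S → Satisfiable S ⊎ d ≡ 0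
  good-satisfiable zero    _                     = inj₂ refl
  good-satisfiable (suc d) (_ , _ , _ , _ , n , _) = inj₁ n

  Adjacent : Set′ → Set′ → Set
  Adjacent A B = ∀ {x y} → A x → B y → x ~ y

  linkˡ : ∀ {X Y : Set′} {b} → X ⊆ N b → ((X ∪ Y) ∩ N b) ≐ (X ∪ (Y ∩ N b))
  linkˡ f = (λ { (inj₁ x , _) → inj₁ x ; (inj₂ y , e) → inj₂ (y , e) }) ,
            (λ { (inj₁ x) → inj₁ x , f x ; (inj₂ (y , e)) → inj₂ y , e })

  linkʳ : ∀ {X Y : Set′} {b} → Y ⊆ N b → ((X ∪ Y) ∩ N b) ≐ ((X ∩ N b) ∪ Y)
  linkʳ f = (λ { (inj₂ x , _) → inj₂ x ; (inj₁ y , e) → inj₁ (y , e) }) ,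
            (λ { (inj₂ x) → inj₂ x , f x ; (inj₁ (y , e)) → inj₁ y , e })

  private
    variable
      a b : ℕ
      A B : Set′

    adjacent-sym : Adjacent A B → Adjacent B A
    adjacent-sym ad b a = ~-sym (ad a b)

    separated : ∀ {x} → Adjacent A B → A x → ¬ B x
    separated ad a b = ~-irrefl (ad a b)

    ∪-interchange : ∀ {C D : Set′} → ((A ∪ B) ∪ (C ∪ D)) ≐ ((A ∪ C) ∪ (B ∪ D))
    ∪-interchange =
      (λ { (inj₁ (inj₁ a)) → inj₁ (inj₁ a) ; (inj₁ (inj₂ b)) → inj₂ (inj₁ b)
         ; (inj₂ (inj₁ c)) → inj₁ (inj₂ c) ; (inj₂ (inj₂ d)) → inj₂ (inj₂ d) }) ,
      (λ { (inj₁ (inj₁ a)) → inj₁ (inj₁ a) ; (inj₁ (inj₂ b)) → inj₂ (inj₁ b)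
         ; (inj₂ (inj₁ c)) → inj₁ (inj₂ c) ; (inj₂ (inj₂ d)) → inj₂ (inj₂ d) })

    good-cast : ∀ {d d′ W S} → d ≡ d′ → Good d W S → Good d′ W S
    good-cast refl g = g

    connected-cast : ∀ {d d′ E b} → d ≡ d′ → Connected d E b → Connected d′ E b
    connected-cast refl c = c

    tame-cast : ∀ {d d′ W S} → d ≡ d′ → Tame d W S → Tame d′ W S
    tame-cast refl t = t

    ∪-assoc : ∀ {C : Set′} → ((A ∪ B) ∪ C) ≐ (A ∪ (B ∪ C))
    ∪-assoc = (λ { (inj₁ (inj₁ a)) → inj₁ a ; (inj₁ (inj₂ b)) → inj₂ (inj₁ b) ; (inj₂ c) → inj₂ (inj₂ c) }) ,
              (λ { (inj₁ a) → inj₁ (inj₁ a) ; (inj₂ (inj₁ b)) → inj₁ (inj₂ b) ; (inj₂ (inj₂ c)) → inj₂ c })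

    empty-∪ : Empty A → (B ∪ A) ≐ B
    empty-∪ e = (λ { (inj₁ b) → b ; (inj₂ a) → ⊥-elim (e _ a) }) , inj₁

    ∪-empty : Empty A → (A ∪ B) ≐ B
    ∪-empty e = (λ { (inj₂ b) → b ; (inj₁ a) → ⊥-elim (e _ a) }) , inj₂

  -- The cliques of the join A ∪ B are the unions of a clique in A and one in B,
  -- hence the sum of the ranks.
  tame-join : ∀ a b {U A W B} → Adjacent A B → Tame a U A → Good b W B → Tame (a + b) (U ∪ W) (A ∪ B)
  -- Without a prescribed initial segment, `A` may be started at a single vertex, which is tame.
  good-join-∅ : ∀ a b {A B} → Adjacent A B → Good a ∅ A → Good b ∅ B → Good (a + b) ∅ (A ∪ B)
  -- The side conditions exclude the bad case of two isolated points in `U` while `W` is empty and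
  -- `b` positive.
  good-join : ∀ a b {U A W B} → Adjacent A B → Good a U A → Good b W B →
    Satisfiable U ⊎ a ≡ 0 → Satisfiable W ⊎ b ≡ 0 → Good (a + b) (U ∪ W) (A ∪ B)

  private
    -- A vertex of `B` sees all of `A`, so its present link is the tame `C` joined with whatever it
    -- sees in `B`. The second part may be empty, so no connectedness in `B` enters.
    join-stepʳ : ∀ a b {C E E′ v} → Adjacent A B → B v → Tame (suc a) C A → E′ ≐ (E ∪ C) →
      GoodStep b B E v → TameStep (a + suc b) (A ∪ B) E′ v
    join-stepʳ {A = A} {B = B} a b {C} {E} {E′} {v} ad v∈B t eq (ne , _ , g) =
      (λ e → case-∪ (proj₁ eq e)) ,
      tame-resp (a + suc b)
        (≐-sym (≐-trans (∩-congˡ (≐-trans eq ∪-comm)) (linkˡ λ c → ad (C⊆A c) v∈B)))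
        (≐-sym (linkˡ λ x → ad x v∈B))
        (tame-cast (sym (+-suc a b))
          (tame-join (suc a) b (λ x (y , _) → ad x y) t g))
      where
      C⊆A : C ⊆ A
      C⊆A = good⇒⊆ (suc a) (tame⇒good (suc a) t)
      case-∪ : (E ∪ C) v → ⊥
      case-∪ (inj₁ e) = ne e
      case-∪ (inj₂ c) = separated ad (C⊆A c) v∈B

    join-stepˡ-tame : ∀ a b {E E′ u} → Adjacent A B → A u → Good b ∅ B → E′ ≐ (E ∪ ∅) →
      TameStep a A E u → TameStep (a + b) (A ∪ B) E′ u
    join-stepˡ-tame a b ad u∈A g eq (ne , t) =
      ne ∘ proj₁ eq′ ,
      tame-resp (a + b) (≐-trans ∪-∅ (∩-congˡ (≐-sym eq′))) (≐-sym (linkʳ λ y → ~-sym (ad u∈A y)))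
        (tame-join a b (λ (x , _) y → ad x y) t g)
      where
      eq′ = ≐-trans eq ∪-∅

    -- The witness of `E` excludes that `u` is the first vertex of `A`. The other two alternatives
    -- of `Connected` are the side condition under which `good-join` applies to the link of `u`.
    join-stepˡ : ∀ a b {C E E′ u} → Adjacent A B → A u → Good b C B → Satisfiable C ⊎ b ≡ 0 →
      Satisfiable E → E′ ≐ (E ∪ C) →
      GoodStep a A E u → GoodStep (a + b) (A ∪ B) E′ u
    join-stepˡ {A = A} {B = B} a b {C} {E} {E′} {u} ad u∈A gB nB (z , z∈E) eq (ne , co , g) =
      (λ e → case-∪ (proj₁ eq e)) ,
      connected nB co ,
      good-resp (a + b)
        (≐-sym (≐-trans (∩-congˡ eq) (linkʳ C⊆N)))
        (≐-sym (linkʳ λ y → ~-sym (ad u∈A y)))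
        (good-join a b (λ (x , _) y → ad x y) g gB (link co) nB)
      where
      C⊆B : C ⊆ B
      C⊆B = good⇒⊆ b gB
      C⊆N : C ⊆ N u
      C⊆N c = ~-sym (ad u∈A (C⊆B c))
      case-∪ : (E ∪ C) u → ⊥
      case-∪ (inj₁ e) = ne e
      case-∪ (inj₂ c) = separated ad u∈A (C⊆B c)
      link : Connected a E u → Satisfiable (E ∩ N u) ⊎ a ≡ 0
      link (inj₁ e)        = ⊥-elim (e z z∈E)
      link (inj₂ (inj₁ z)) = inj₂ z
      link (inj₂ (inj₂ x)) = inj₁ x
      connected : Satisfiable C ⊎ b ≡ 0 → Connected a E u → Connected (a + b) E′ u
      connected (inj₁ (c , c∈)) _ = inj₂ (inj₂ (c , proj₂ eq (inj₂ c∈) , C⊆N c∈))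
      connected (inj₂ refl) (inj₁ e) = ⊥-elim (e z z∈E)
      connected (inj₂ refl) (inj₂ (inj₁ refl)) = inj₂ (inj₁ refl)
      connected (inj₂ refl) (inj₂ (inj₂ (x , x∈ , e))) = inj₂ (inj₂ (x , proj₂ eq (inj₁ x∈) , e))

    steps-joinˡ : ∀ a b l {C E E′} → Adjacent A B → (∀ {y} → y ∈ l → A y) →
      Good b C B → Satisfiable C ⊎ b ≡ 0 → E′ ≐ (E ∪ C) → Satisfiable E →
      Steps (GoodStep a A) E l → Steps (GoodStep (a + b) (A ∪ B)) E′ l
    steps-joinˡ a b [] _ _ _ _ _ _ _ = tt
    steps-joinˡ a b (y ∷ l) ad f g n eq (z , z∈) (p , ps) =
      join-stepˡ a b ad (f (here refl)) g n (z , z∈) eq p ,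
      steps-joinˡ a b l ad (f ∘ there) g n (≐-trans (∪-cong eq ≐-refl) ∪-swap) (z , inj₁ z∈) ps

    steps-joinʳ : ∀ a b l {C E E′} → Adjacent A B → (∀ {y} → y ∈ l → B y) →
      Good (suc a) C A → Satisfiable C → E′ ≐ (E ∪ C) → Satisfiable E →
      Steps (GoodStep b B) E l → Steps (GoodStep (a + suc b) (A ∪ B)) E′ l
    steps-joinʳ {A = A} {B = B} a b l ad f g n eq z st =
      map-steps ∅ l (≐-sym ∪-∅) (λ _ eq′ (ne , co , g) → let eq″ = ≐-trans eq′ ∪-∅ in
          ne ∘ proj₁ eq″ , connected-cast d≡ (connected-resp (≐-sym eq″) co) ,
          good-resp (a + suc b) (∩-congˡ (≐-sym eq″)) (∩-congˡ ∪-comm) (good-cast d≡ g))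
        (steps-joinˡ b (suc a) l (adjacent-sym ad) f g (inj₁ n) eq z st)
      where
      d≡ : b + suc a ≡ a + suc b
      d≡ = trans (+-suc b a) (trans (cong suc (+-comm b a)) (sym (+-suc a b)))

  tame-join (suc a) zero ad t (e , e′) =
    tame-resp (suc a + 0) (≐-sym (empty-∪ e′)) (≐-sym (empty-∪ e))
      (tame-cast (sym (+-identityʳ (suc a))) t)
  tame-join (suc a) (suc b) {U} {A} {W} {B} ad t@(x , u , u′ , U≐ , A≐ , g , st₁ , st₂) gB@(w , w′ , W≐ , B≐ , n , st) =
    -- The order is `U`, `W`, the rest of `B`, the rest of `A`. Thus `U` is built with `B` absent,
    -- each vertex of `B` sees the tame `U`, and the rest of `A` sees all of the nonempty `B`.
    x , u ++ w , w′ ++ u′ ,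
    ≐-trans (∪-cong U≐ W≐) (≐-sym (++-≐ (x ∷ u))) ,
    ≐-trans (∪-cong (≐-trans A≐ (++-≐ (x ∷ u))) (≐-trans B≐ (++-≐ w)))
      (≐-trans ∪-interchange (≐-trans (∪-cong (≐-sym (++-≐ (x ∷ u))) (≐-trans ∪-comm (≐-sym (++-≐ w′))))
        (≐-sym (++-≐ (x ∷ u ++ w))))) ,
    good-resp (a + suc b) ≐-refl (≐-sym (linkʳ λ y → ~-sym (ad x∈A y)))
      (good-join-∅ a (suc b) (λ (p , _) q → ad p q) g (good-∅ (suc b) gB)) ,
    steps-++ u (tameStep-resp (a + suc b)) ≐-refl
      (map-steps ∅ u (≐-sym ∪-∅)
        (λ m eq → join-stepˡ-tame a (suc b) ad (A∋ (there (∈-++⁺ˡ m))) (good-∅ (suc b) gB) eq) st₁)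
      (map-steps U w (≐-trans (≐-trans (≐-sym ∷-≐) (≐-sym U≐)) (≐-sym ∅-∪))
        (λ m → join-stepʳ a b ad (proj₂ B≐ (∈-++⁺ˡ m)) t) (proj₁ stᴮ)) ,
    steps-++ w′ (goodStep-resp (a + suc b)) ≐-refl
      (map-steps U w′ (≐-trans (++-≐ (x ∷ u)) (≐-trans (∪-cong (≐-sym U≐) ≐-refl)
          (≐-trans ∪-comm (∪-cong (≐-sym ∅-∪) ≐-refl))))
        (λ m eq st → tameStep⇒goodStep (a + suc b) (join-stepʳ a b ad (proj₂ B≐ (∈-++⁺ʳ w m)) t eq st)) (proj₂ stᴮ))
      (steps-joinˡ a (suc b) u′ ad (λ m → A∋ (there (∈-++⁺ʳ u m))) (good-all (suc b) gB) (inj₁ n)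
        (≐-trans (∪-cong (++-≐ (x ∷ u)) ≐-refl) (≐-trans ∪-assoc (∪-cong ≐-refl (≐-trans (≐-sym (++-≐ w)) (≐-sym B≐)))))
        (x , here refl) st₂)
    where
    A∋ : ∀ {y} → y ∈ x ∷ u ++ u′ → A y
    A∋ = proj₂ A≐
    x∈A = A∋ (here refl)
    stᴮ = steps-++⁻ w (goodStep-resp b) st

  good-join-∅ zero b ad (e , _) g = good-resp b ≐-refl (≐-sym (∪-empty e)) g
  good-join-∅ (suc a) b ad g g′ =
    good-∅ (suc a + b) (tame⇒good (suc a + b) (tame-join (suc a) b ad (proj₂ (good⇒tame-∅ a g)) g′))

  good-join zero b {U} {A} {W} {B} ad gA@(e , _) g _ _ =
    good-resp b (≐-sym (∪-empty λ x → e x ∘ good⇒⊆ 0 {U} {A} gA)) (≐-sym (∪-empty e)) g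
  good-join (suc a) zero ad g (e , e′) _ _ =
    good-resp (suc a + 0) (≐-sym (empty-∪ e′)) (≐-sym (empty-∪ e)) (good-cast (sym (+-identityʳ (suc a))) g)
  good-join (suc a) (suc b) ad ([] , _ , U≐ , _) _ (inj₁ (_ , y)) _ with () ← proj₁ U≐ y
  good-join (suc a) (suc b) {U} {A} {W} {B} ad
    gA@(x ∷ u , u′ , U≐ , A≐ , nA , ((_ , _ , g) , st)) gB@(w , w′ , W≐ , B≐ , nB , st′) nU@(inj₁ sU) nW@(inj₁ sW) =
    -- `U` need not be tame here, so only its first vertex `x` precedes `W`. Once `W` is present,
    -- the rest of `U` has neighbours in `W`, and the rest of `B` has neighbours in `U`.
    x ∷ w ++ u , w′ ++ u′ ,
    ≐-trans (≐-trans (∪-cong (≐-trans U≐ ∷-≐) W≐) ∪-swap) (≐-trans (∪-cong (≐-sym ∷-≐) ≐-refl) (≐-sym (++-≐ (x ∷ w)))) ,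
    ≐-trans (∪-cong (≐-trans A≐ (++-≐ (x ∷ u))) (≐-trans B≐ (++-≐ w)))
      (≐-trans ∪-interchange (≐-trans (∪-cong W₁≐ (≐-trans ∪-comm (≐-sym (++-≐ w′))))
        (≐-sym (++-≐ (x ∷ w ++ u))))) ,
    (x , inj₁ x∈A) ,
    ((λ ()) , inj₁ (λ _ ()) ,
     good-resp (a + suc b) ((λ ()) , λ ()) (≐-sym (linkʳ λ y → ~-sym (ad x∈A y)))
       (good-join-∅ a (suc b) (λ (p , _) q → ad p q) (good-∅ a g) (good-∅ (suc b) gB))) ,
    steps-++ (w ++ u) (goodStep-resp (a + suc b)) ≐-refl
      (steps-++ w (goodStep-resp (a + suc b)) ≐-refl
        (map-steps ｛ x ｝ w ≐-refl
          (λ m eq s → tameStep⇒goodStep (a + suc b) (join-stepʳ a b ad (proj₂ B≐ (∈-++⁺ˡ m)) root eq s)) (proj₁ stᴮ))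
        (steps-joinˡ a (suc b) u ad (λ m → proj₂ A≐ (there (∈-++⁺ˡ m))) gB nW
          (∪-cong ≐-refl (≐-sym W≐)) (x , inj₂ refl) (proj₁ stᴬ)))
      (steps-++ w′ (goodStep-resp (a + suc b)) ≐-refl
        (steps-joinʳ a b w′ ad (λ m → proj₂ B≐ (∈-++⁺ʳ w m)) gA sU
          (≐-trans (∪-cong ∅-∪ (++-≐ w)) (≐-trans (≐-trans (≐-sym ∪-assoc) ∪-swap)
            (≐-trans (∪-cong (≐-trans (≐-sym ∷-≐) (≐-sym U≐)) ≐-refl) (≐-trans ∪-comm (∪-cong (≐-sym ∅-∪) ≐-refl)))))
          (proj₁ sW , inj₂ (proj₁ W≐ (proj₂ sW))) (proj₂ stᴮ))
        (steps-joinˡ a (suc b) u′ ad (λ m → proj₂ A≐ (there (∈-++⁺ʳ u m))) (good-all (suc b) gB) (inj₁ nB)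
          (≐-trans (∪-cong (≐-trans (∪-cong ≐-refl (++-≐ w)) (≐-trans (≐-sym ∪-assoc) ∪-swap)) ≐-refl)
            (≐-trans ∪-assoc (∪-cong ≐-refl (≐-trans (≐-sym (++-≐ w)) (≐-sym B≐)))))
          (x , inj₁ (inj₂ refl)) (proj₂ stᴬ)))
    where
    x∈A : A x
    x∈A = proj₂ A≐ (here refl)
    stᴮ = steps-++⁻ w (goodStep-resp b) st′
    stᴬ = steps-++⁻ u (goodStep-resp a) st
    W₁≐ : ((_∈ x ∷ u) ∪ (_∈ w)) ≐ (_∈ x ∷ w ++ u)
    W₁≐ = ≐-trans (≐-trans (∪-cong ∷-≐ ≐-refl) ∪-swap) (≐-trans (∪-cong (≐-sym ∷-≐) ≐-refl) (≐-sym (++-≐ (x ∷ w))))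
    root : Tame (suc a) ｛ x ｝ A
    root = x , [] , u ++ u′ , ((λ { refl → here refl }) , λ { (here refl) → refl }) , A≐ ,
      good-∅ a g , tt ,
      steps-resp (u ++ u′) (goodStep-resp a) ((λ { (inj₂ refl) → here refl }) , λ { (here refl) → inj₂ refl }) st

-- Precedence in lists, and lists grouped by first letter

module _ {A : Set} where

  -- The relation is between positions: `Before xs p p` says that `p` occurs twice, so refuting it
  -- proves that there are no repetitions.
  data Before : List A → A → A → Set where
    here  : ∀ {p q xs} → q ∈ xs → Before (p ∷ xs) p q
    there : ∀ {p q x xs} → Before xs p q → Before (x ∷ xs) p q

  before⇒∈ˡ : ∀ {xs p q} → Before xs p q → p ∈ xs
  before⇒∈ˡ (here _)  = here refl
  before⇒∈ˡ (there b) = there (before⇒∈ˡ b)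

  before⇒∈ʳ : ∀ {xs p q} → Before xs p q → q ∈ xs
  before⇒∈ʳ (here m)  = there m
  before⇒∈ʳ (there b) = there (before⇒∈ʳ b)

  before-++⁺ˡ : ∀ {xs ys p q} → Before xs p q → Before (xs ++ ys) p q
  before-++⁺ˡ (here m)  = here (∈-++⁺ˡ m)
  before-++⁺ˡ (there b) = there (before-++⁺ˡ b)

  before-++⁺ʳ : ∀ xs {ys p q} → Before ys p q → Before (xs ++ ys) p q
  before-++⁺ʳ []       b = b
  before-++⁺ʳ (_ ∷ xs) b = there (before-++⁺ʳ xs b)

  before-++⁺ : ∀ {xs ys p q} → p ∈ xs → q ∈ ys → Before (xs ++ ys) p q
  before-++⁺ {_ ∷ xs} (here refl) m′ = here (∈-++⁺ʳ xs m′)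
  before-++⁺ (there m)   m′ = there (before-++⁺ m m′)

  before-++⁻ : ∀ xs {ys p q} → Before (xs ++ ys) p q → Before xs p q ⊎ p ∈ xs × q ∈ ys ⊎ Before ys p q
  before-++⁻ []       b        = inj₂ (inj₂ b)
  before-++⁻ (_ ∷ xs) (here m) with ∈-++⁻ xs m
  ... | inj₁ m′ = inj₁ (here m′)
  ... | inj₂ m′ = inj₂ (inj₁ (here refl , m′))
  before-++⁻ (_ ∷ xs) (there b) with before-++⁻ xs b
  ... | inj₁ b′               = inj₁ (there b′)
  ... | inj₂ (inj₁ (m , m′)) = inj₂ (inj₁ (there m , m′))
  ... | inj₂ (inj₂ b′)        = inj₂ (inj₂ b′)

before-map⁺ : ∀ {A B : Set} (f : A → B) {xs p q} → Before xs p q → Before (map f xs) (f p) (f q)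
before-map⁺ f (here m)  = here (∈-map⁺ f m)
before-map⁺ f (there b) = there (before-map⁺ f b)

before-map⁻ : ∀ {A B : Set} (f : A → B) xs {u v} → Before (map f xs) u v →
  ∃[ p ] ∃[ q ] u ≡ f p × v ≡ f q × Before xs p q
before-map⁻ f (x ∷ xs) (here m) = let q , q∈ , eq = ∈-map⁻ f m in x , q , refl , eq , here q∈
before-map⁻ f (x ∷ xs) (there b) = let p , q , e , e′ , b′ = before-map⁻ f xs b in p , q , e , e′ , there b′

module _ {V : Set} (f : V → List (List V)) where

  -- With `f b` the list of tails allowed after `b`, this is a lexicographic order in which the
  -- order of the later letters may depend on the earlier ones.
  blocks : List V → List (List V)
  blocks []      = []
  blocks (b ∷ l) = map (b ∷_) (f b) ++ blocks l

  ∈-blocks⁺ : ∀ {l b w} → b ∈ l → w ∈ f b → b ∷ w ∈ blocks l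
  ∈-blocks⁺ (here refl) m = ∈-++⁺ˡ (∈-map⁺ _ m)
  ∈-blocks⁺ {b ∷ l} (there i)   m = ∈-++⁺ʳ (map (b ∷_) (f b)) (∈-blocks⁺ i m)

  ∈-blocks⁻ : ∀ l {v} → v ∈ blocks l → ∃[ b ] ∃[ w ] v ≡ b ∷ w × b ∈ l × w ∈ f b
  ∈-blocks⁻ (b ∷ l) m with ∈-++⁻ (map (b ∷_) (f b)) m
  ... | inj₁ m′ = let w , w∈ , eq = ∈-map⁻ _ m′ in b , w , eq , here refl , w∈
  ... | inj₂ m′ = let b′ , w , eq , b∈ , w∈ = ∈-blocks⁻ l m′ in b′ , w , eq , there b∈ , w∈

  before-blocks⁺ : ∀ {l b b′ w w′} → Before l b b′ → w ∈ f b → w′ ∈ f b′ → Before (blocks l) (b ∷ w) (b′ ∷ w′)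
  before-blocks⁺ (here m) i i′ = before-++⁺ (∈-map⁺ _ i) (∈-blocks⁺ m i′)
  before-blocks⁺ {c ∷ l} (there b) i i′ = before-++⁺ʳ (map (c ∷_) (f c)) (before-blocks⁺ b i i′)

  before-block⁺ : ∀ {l b w w′} → b ∈ l → Before (f b) w w′ → Before (blocks l) (b ∷ w) (b ∷ w′)
  before-block⁺ (here refl) i = before-++⁺ˡ (before-map⁺ _ i)
  before-block⁺ {c ∷ l} (there b) i = before-++⁺ʳ (map (c ∷_) (f c)) (before-block⁺ b i)

  before-blocks⁻ : ∀ l {v v′} → Before (blocks l) v v′ →
    (∃[ b ] ∃[ b′ ] ∃[ w ] ∃[ w′ ] v ≡ b ∷ w × v′ ≡ b′ ∷ w′ × Before l b b′ × w ∈ f b × w′ ∈ f b′) ⊎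
    (∃[ b ] ∃[ w ] ∃[ w′ ] v ≡ b ∷ w × v′ ≡ b ∷ w′ × b ∈ l × Before (f b) w w′)
  before-blocks⁻ (b ∷ l) i with before-++⁻ (map (b ∷_) (f b)) i
  ... | inj₁ i′ = let w , w′ , e , e′ , j = before-map⁻ _ (f b) i′ in
    inj₂ (b , w , w′ , e , e′ , here refl , j)
  ... | inj₂ (inj₁ (m , m′)) =
    let w , w∈ , e = ∈-map⁻ _ m ; b′ , w′ , e′ , b∈ , w∈′ = ∈-blocks⁻ l m′ in
    inj₁ (b , b′ , w , w′ , e , e′ , here b∈ , w∈ , w∈′)
  ... | inj₂ (inj₂ i′) with before-blocks⁻ l i′
  ...   | inj₁ (b , b′ , w , w′ , e , e′ , j , r) = inj₁ (b , b′ , w , w′ , e , e′ , there j , r)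
  ...   | inj₂ (b , w , w′ , e , e′ , j , r)      = inj₂ (b , w , w′ , e , e′ , there j , r)

-- Maximal cliques as words, and their lexicographic order

module Words {V : Set} (_~_ : V → V → Set)
  (~-sym : ∀ {x y} → x ~ y → y ~ x) (~-irrefl : ∀ {x} → ¬ x ~ x)
  (_≟_ : DecidableEquality V) where

  open Orderings _~_ ~-sym ~-irrefl
  open DecMembership _≟_ using (_∈?_)

  Clique : Set′ → List V → Set
  Clique S []      = ⊤
  Clique S (b ∷ w) = S b × Clique (S ∩ N b) w

  infix 4 _≈_
  _≈_ : List V → List V → Set
  xs ≈ ys = (_∈ xs) ≐ (_∈ ys)

  -- Reading a word w as the flag of the sets of its first j letters: r shares
  -- with q all members of its flag but one, which p lacks as well.
  Between : ℕ → List V → List V → List V → Set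
  Between d p q r = ∃[ k ] k < d ×
    ¬ take (suc k) p ≈ take (suc k) q × ¬ take (suc k) r ≈ take (suc k) q ×
    (∀ j → j ≤ d → j ≢ suc k → take j r ≈ take j q)

  -- `separating` is the shelling condition in terms of flags. `initial` strengthens the induction:
  -- in the link of `b`, the words that begin with an earlier neighbour of `b` come first.
  record Enumeration (d : ℕ) (W S : Set′) : Set where
    field
      words      : List (List V)
      sound      : ∀ {w} → w ∈ words → length w ≡ d × Clique S w
      complete   : ∀ {w} → length w ≡ d → Clique S w → w ∈ words
      initial    : ∀ {c p c′ q} → c ∷ p ∈ words → W c → c′ ∷ q ∈ words → ¬ W c′ →
                   Before words (c ∷ p) (c′ ∷ q)
      separating : ∀ {p q} → Before words p q → ∃[ r ] Before words r q × Between d p q r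

  open Enumeration

  clique-mono : ∀ {S S′} w → S ⊆ S′ → Clique S w → Clique S′ w
  clique-mono []      f _       = tt
  clique-mono (b ∷ w) f (s , c) = f s , clique-mono w (λ (x , e) → f x , e) c

  clique⇒⊆ : ∀ {S} w {x} → Clique S w → x ∈ w → S x
  clique⇒⊆ (b ∷ w) (s , c) (here refl) = s
  clique⇒⊆ (b ∷ w) (s , c) (there m)   = proj₁ (clique⇒⊆ w c m)

  clique⇒∉ : ∀ {S} b w → Clique (S ∩ N b) w → b ∉ w
  clique⇒∉ b w c m = ~-irrefl (proj₂ (clique⇒⊆ w c m))

  ∈-take⁻ : ∀ {A : Set} k {xs} {x : A} → x ∈ take k xs → x ∈ xs
  ∈-take⁻ (suc k) {_ ∷ _} (here e)  = here e
  ∈-take⁻ (suc k) {_ ∷ _} (there m) = there (∈-take⁻ k m)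

  data Delete (b : V) : List V → List V → Set where
    here  : ∀ {p} → b ∉ p → Delete b (b ∷ p) p
    there : ∀ {a p p′} → a ≢ b → Delete b p p′ → Delete b (a ∷ p) (a ∷ p′)

  delete : ∀ {S b} p → Clique S p → b ∈ p → ∃[ p′ ] Delete b p p′
  delete (b ∷ p) (_ , c) (here refl) = p , here (clique⇒∉ b p c)
  delete (a ∷ p) (_ , c) (there m)   =
    let p′ , d = delete p c m in a ∷ p′ , there (λ { refl → clique⇒∉ a p c m }) d

  delete-length : ∀ {b p p′} → Delete b p p′ → length p ≡ suc (length p′)
  delete-length (here _)    = refl
  delete-length (there _ d) = cong suc (delete-length d)

  delete-clique : ∀ {S b p p′} → Clique S p → Delete b p p′ → S b × Clique (S ∩ N b) p′
  delete-clique (s , c) (here _) = s , c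
  delete-clique {p = a ∷ p} {a ∷ p′} (s , c) (there _ d) =
    let (s′ , e) , c′ = delete-clique c d in
    s′ , (s , ~-sym e) , clique-mono p′ (λ ((x , e₁) , e₂) → (x , e₂) , e₁) c′

  take-delete : ∀ {b p p′} k → Delete b p p′ → b ∈ take (suc k) p →
    (_∈ take k p′) ≐ (λ x → x ∈ take (suc k) p × x ≢ b)
  take-delete k (here nb) _ =
    (λ m → there m , λ { refl → nb (∈-take⁻ k m) }) ,
    (λ { (here refl , ne) → ⊥-elim (ne refl) ; (there m , _) → m })
  take-delete zero    (there ne d) (here refl) = ⊥-elim (ne refl)
  take-delete (suc k) (there ne d) (here refl) = ⊥-elim (ne refl)
  take-delete (suc k) (there ne d) (there m)   = let f , g = take-delete k d m in
    (λ { (here refl) → here refl , ne ; (there i) → there (proj₁ (f i)) , proj₂ (f i) }) ,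
    (λ { (here refl , _) → here refl ; (there i , ne′) → there (g (i , ne′)) })

  private
    variable
      d : ℕ
      S : Set′

  ∷-≈⁻ : ∀ {b xs ys} → b ∉ xs → b ∉ ys → b ∷ xs ≈ b ∷ ys → xs ≈ ys
  ∷-≈⁻ nx ny (f , g) = drop nx f , drop ny g
    where
    drop : ∀ {b xs ys} → b ∉ xs → (∀ {x} → x ∈ b ∷ xs → x ∈ b ∷ ys) → ∀ {x} → x ∈ xs → x ∈ ys
    drop nx f m with f (there m)
    ... | here refl = ⊥-elim (nx m)
    ... | there m′  = m′

  ∷-≈⁺ : ∀ {b xs ys} → xs ≈ ys → b ∷ xs ≈ b ∷ ys
  ∷-≈⁺ (f , g) = (λ { (here e) → here e ; (there m) → there (f m) }) ,
                 (λ { (here e) → here e ; (there m) → there (g m) })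

  -- The word `p` need not begin with `b`. It is enough that `p′` agrees with `q` on a prefix
  -- whenever `p` agrees with `b ∷ q` on the next longer one. This lets a word with another first
  -- letter be compared inside the link of `b`.
  between-∷ : ∀ {b p p′ q r} → b ∉ q → b ∉ r →
    (∀ k → take (suc k) p ≈ take (suc k) (b ∷ q) → take k p′ ≈ take k q) →
    Between d p′ q r → Between (suc d) p (b ∷ q) (b ∷ r)
  between-∷ nq nr h (k , k< , np , ne , eq) =
    suc k , s≤s k< , np ∘ h (suc k) ,
    ne ∘ ∷-≈⁻ (nr ∘ ∈-take⁻ (suc k)) (nq ∘ ∈-take⁻ (suc k)) ,
    λ { zero _ _ → ≐-refl ; (suc j) (s≤s j≤) ne′ → ∷-≈⁺ (eq j j≤ (ne′ ∘ cong suc)) }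

  -- This is purity of the clique complex: links of good sets are good, and a good set of positive
  -- rank is nonempty.
  extend : ∀ d {W S} w → Good d W S → length w ≤ d → Clique S w →
    ∃[ u ] length (w ++ u) ≡ d × Clique S (w ++ u)
  fill : ∀ d {W S} → Good d W S → ∃[ u ] length u ≡ d × Clique S u

  private
    steps-fresh : ∀ {P : Set′ → V → Set} {E} l → (∀ {E b} → P E b → ¬ E b) →
      Steps P E l → ∀ {b} → b ∈ l → ¬ E b
    steps-fresh (b ∷ l) f (p , ps) (here refl) = f p
    steps-fresh (b ∷ l) f (p , ps) (there m) e = steps-fresh l f ps m (inj₁ e)

    -- No step adds a vertex that is already present, so `l` has no repetitions and `b` determines
    -- the stage at which it was added.
    steps-lookup : ∀ {P : Set′ → V → Set} {E} l → Respects≐ P → (∀ {E b} → P E b → ¬ E b) →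
      Steps P E l → ∀ {b} → b ∈ l → P (E ∪ (λ x → Before l x b)) b
    steps-lookup (c ∷ l) r f (p , ps) (here refl) = r (inj₁ , λ { (inj₁ e) → e ; (inj₂ i) → ⊥-elim (none i) }) p
      where
      c∉l : c ∉ l
      c∉l m = steps-fresh l f ps m (inj₂ refl)
      none : ∀ {x} → Before (c ∷ l) x c → ⊥
      none (here m)  = c∉l m
      none (there i) = c∉l (before⇒∈ʳ i)
    steps-lookup (c ∷ l) r f (p , ps) (there m) = r
      ((λ { (inj₁ (inj₁ e)) → inj₁ e ; (inj₁ (inj₂ refl)) → inj₂ (here m) ; (inj₂ i) → inj₂ (there i) }) ,
       (λ { (inj₁ e) → inj₁ (inj₁ e) ; (inj₂ (here _)) → inj₁ (inj₂ refl) ; (inj₂ (there i)) → inj₂ i }))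
      (steps-lookup l r f ps m)

  good-lookup : ∀ d l → Steps (GoodStep d S) ∅ l → ∀ {b} → b ∈ l → GoodStep d S (λ x → Before l x b) b
  good-lookup d l st m = goodStep-resp d ∅-∪ (steps-lookup l (goodStep-resp d) proj₁ st m)

  good-link : ∀ d {W S b} → Good (suc d) W S → S b → ∃[ W′ ] Good d W′ (S ∩ N b)
  good-link d (l₁ , l₂ , _ , s , _ , st) b∈ =
    _ , proj₂ (proj₂ (good-lookup d (l₁ ++ l₂) st (proj₁ s b∈)))

  fill zero    g = [] , refl , tt
  fill (suc d) g@(_ , _ , _ , _ , (b , b∈) , _) =
    let _ , g′ = good-link d g b∈ ; u , e , c = fill d g′ in b ∷ u , cong suc e , b∈ , c

  extend d [] g _ _ = fill d g
  extend (suc d) (b ∷ w) g (s≤s l) (b∈ , c) =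
    let _ , g′ = good-link d g b∈ ; u , e , c′ = extend d w g′ l c in u , cong suc e , b∈ , c′

  before? : ∀ l x y → Dec (Before l x y)
  before? [] x y = no λ ()
  before? (z ∷ l) x y with x ≟ z | y ∈? l | before? l x y
  ... | _        | _     | yes i = yes (there i)
  ... | yes refl | yes m | _     = yes (here m)
  ... | no ne    | _     | no ¬i = no λ { (here _) → ne refl ; (there i) → ¬i i }
  ... | yes _    | no ¬m | no ¬i = no λ { (here m) → ¬m m ; (there i) → ¬i i }

  -- Words with equal first letters are separated in the link of that letter. Otherwise let `q` be
  -- `b′ ∷ c ∷ w″`. If `c` precedes `b′`, exchange these two letters of `q`. If not, move `p` into
  -- the link of `b′` as a word that begins with an earlier neighbour of `b′`; by `initial` it
  -- precedes `c ∷ w″`, and induction applies there.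
  enumerate : ∀ d {W S} → Good d W S → Enumeration d W S
  enumerate zero g = record
    { words      = [] ∷ []
    ; sound      = λ { (here refl) → refl , tt }
    ; complete   = λ { {[]} _ _ → here refl }
    ; initial    = λ { (here ()) ; (there ()) }
    ; separating = λ { (here ()) ; (there ()) }
    }
  enumerate (suc d) {W} {S} (l₁ , l₂ , W≐ , S≐ , _ , st) = record
    { words      = blocks f l
    ; sound      = sound′
    ; complete   = λ { {b ∷ w} e (s , c) → ∈-blocks⁺ f (proj₁ S≐ s) (∈f⁺ (proj₁ S≐ s) (suc-injective e) c) }
    ; initial    = λ m w m′ ¬w → before-blocks⁺ f
        (before-++⁺ (proj₁ W≐ w) (∉l₁ (head∈ m′) (¬w ∘ proj₂ W≐))) (tail∈ m) (tail∈ m′)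
    ; separating = separating′
    }
    where
    l = l₁ ++ l₂

    lookup-step : ∀ {b} → b ∈ l → GoodStep d S (λ x → Before l x b) b
    lookup-step = good-lookup d l st

    Link : V → Set
    Link b = Enumeration d ((λ x → Before l x b) ∩ N b) (S ∩ N b)

    link : ∀ {b} → b ∈ l → Link b
    link m = enumerate d (proj₂ (proj₂ (lookup-step m)))

    f : V → List (List V)
    f b with b ∈? l
    ... | yes m = words (link m)
    ... | no  _ = []

    -- `f` uses the membership proof found by the decision procedure, which may differ from `m`;
    -- hence only the existence of the enumeration is recorded.
    f-link : ∀ {b} → b ∈ l → Σ[ e ∈ Link b ] f b ≡ words e
    f-link {b} m with b ∈? l
    ... | yes m′ = link m′ , refl
    ... | no ¬m  = ⊥-elim (¬m m)

    ∈f⁺ : ∀ {b w} → b ∈ l → length w ≡ d → Clique (S ∩ N b) w → w ∈ f b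
    ∈f⁺ m le c = let e , eq = f-link m in subst (_ ∈_) (sym eq) (complete e le c)

    ∈f⁻ : ∀ {b w} → b ∈ l → w ∈ f b → length w ≡ d × Clique (S ∩ N b) w
    ∈f⁻ m i = let e , eq = f-link m in sound e (subst (_ ∈_) eq i)

    sound′ : ∀ {w} → w ∈ blocks f l → length w ≡ suc d × Clique S w
    sound′ m with ∈-blocks⁻ f l m
    ... | b , w , refl , b∈ , w∈ = let le , c = ∈f⁻ b∈ w∈ in cong suc le , proj₂ S≐ b∈ , c

    head∈ : ∀ {b w} → b ∷ w ∈ blocks f l → b ∈ l
    head∈ m with ∈-blocks⁻ f l m
    ... | _ , _ , refl , b∈ , _ = b∈

    tail∈ : ∀ {b w} → b ∷ w ∈ blocks f l → w ∈ f b
    tail∈ m with ∈-blocks⁻ f l m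
    ... | _ , _ , refl , _ , w∈ = w∈

    ∉l₁ : ∀ {b} → b ∈ l → b ∉ l₁ → b ∈ l₂
    ∉l₁ m ¬m with ∈-++⁻ l₁ m
    ... | inj₁ m′ = ⊥-elim (¬m m′)
    ... | inj₂ m′ = m′

    ≢-heads : ∀ {b b′} → Before l b b′ → b ≢ b′
    ≢-heads i refl = proj₁ (lookup-step (before⇒∈ʳ i)) i

    [≢] : ∀ {b b′} → b ≢ b′ → ¬ (b ∷ [] ≈ b′ ∷ [])
    [≢] ne (g , _) with g (here refl)
    ... | here e = ne e

    descend : ∀ {b p p′ w′} → b ∈ l → Before (f b) p′ w′ →
      (∀ k → take (suc k) p ≈ take (suc k) (b ∷ w′) → take k p′ ≈ take k w′) →
      ∃[ r ] Before (blocks f l) r (b ∷ w′) × Between (suc d) p (b ∷ w′) r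
    descend {b} {p} {p′} {w′} m i h =
      let e , eq = f-link m
          r , i′ , bt = separating e (subst (λ ws → Before ws p′ w′) eq i)
          i″ = subst (λ ws → Before ws r w′) (sym eq) i′
      in b ∷ r , before-block⁺ f m i″ ,
         between-∷ (clique⇒∉ b w′ (proj₂ (∈f⁻ m (before⇒∈ʳ i″)))) (clique⇒∉ b r (proj₂ (∈f⁻ m (before⇒∈ˡ i″)))) h bt

    -- The word p′ is p with b′ deleted if b′ occurs in p, and otherwise arbitrary.
    restrict : ∀ {b b′ w w′ x} → 1 ≤ d → Before l b b′ → b ∷ w ∈ blocks f l → w′ ∈ f b′ →
      Before l x b′ → x ~ b′ →
      ∃[ c ] ∃[ p ] c ∷ p ∈ f b′ × Before l c b′ × c ~ b′ ×
        (∀ k → take (suc k) (b ∷ w) ≈ take (suc k) (b′ ∷ w′) → take k (c ∷ p) ≈ take k w′)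
    restrict {b} {b′} {w} {w′} {x} 1≤d i p∈ w′∈ j a with b′ ∈? (b ∷ w)
    -- Every nonempty prefix of `b′ ∷ w′` contains `b′`, so `p` agrees with none of them and the
    -- last condition is vacuous.
    ... | no ∉p = x , proj₁ ex , ∈f⁺ b′∈ (proj₁ (proj₂ ex)) (proj₂ (proj₂ ex)) , j , a ,
          λ k (_ , g) → ⊥-elim (∉p (∈-take⁻ (suc k) {b ∷ w} (g (here refl))))
      where
      b′∈ = before⇒∈ʳ i
      ex : ∃[ u ] length (x ∷ u) ≡ d × Clique (S ∩ N b′) (x ∷ u)
      ex = extend d (x ∷ []) (proj₂ (proj₂ (lookup-step b′∈))) 1≤d ((proj₂ S≐ (before⇒∈ˡ j) , a) , tt)
    ... | yes m with delete (b ∷ w) (proj₂ (sound′ p∈)) m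
    ...   | p′ , here _ = ⊥-elim (≢-heads i refl)
    ...   | b ∷ p′ , dl@(there ne _) =
      b , p′ , ∈f⁺ b′∈ (suc-injective (trans (sym (delete-length dl)) (proj₁ (sound′ p∈)))) c , i ,
      proj₂ (proj₁ c) , agree
      where
      b′∈ = before⇒∈ʳ i
      c = proj₂ (delete-clique (proj₂ (sound′ p∈)) dl)
      nb : b′ ∉ w′
      nb = clique⇒∉ b′ w′ (proj₂ (∈f⁻ b′∈ w′∈))
      agree : ∀ k → take (suc k) (b ∷ w) ≈ take (suc k) (b′ ∷ w′) → take k (b ∷ p′) ≈ take k w′
      agree k (g , h) = let s , t = take-delete k dl (h (here refl)) in
        (λ y → tail (g (proj₁ (s y))) (proj₂ (s y))) ,
        (λ y → t (h (there y) , λ { refl → nb (∈-take⁻ k y) }))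
        where
        tail : ∀ {x xs} → x ∈ b′ ∷ xs → x ≢ b′ → x ∈ xs
        tail (here e)  ne = ⊥-elim (ne e)
        tail (there m) _  = m

    separating′ : ∀ {p q} → Before (blocks f l) p q →
      ∃[ r ] Before (blocks f l) r q × Between (suc d) p q r
    separating′ i with before-blocks⁻ f l i
    ... | inj₂ (b , w , w′ , refl , refl , b∈ , j) = descend b∈ j λ k →
      ∷-≈⁻ (clique⇒∉ b w (proj₂ (∈f⁻ b∈ (before⇒∈ˡ j))) ∘ ∈-take⁻ k)
           (clique⇒∉ b w′ (proj₂ (∈f⁻ b∈ (before⇒∈ʳ j))) ∘ ∈-take⁻ k)
    ... | inj₁ (b , b′ , w , w′ , refl , refl , j , w∈ , w′∈) = heads w′ w′∈ i (proj₁ (proj₂ (lookup-step b′∈)))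
      where
      b′∈ = before⇒∈ʳ j
      heads-0 : ∀ {w′} → Before (blocks f l) (b ∷ w) (b′ ∷ w′) → d ≡ 0 →
        ∃[ r ] Before (blocks f l) r (b′ ∷ w′) × Between (suc d) (b ∷ w) (b′ ∷ w′) r
      heads-0 i refl = b ∷ w , i , 0 , s≤s z≤n , [≢] (≢-heads j) , [≢] (≢-heads j) ,
        λ { zero _ _ → ≐-refl ; (suc zero) _ ne → ⊥-elim (ne refl) ; (suc (suc _)) (s≤s ()) _ }
      heads : ∀ w′ → w′ ∈ f b′ → Before (blocks f l) (b ∷ w) (b′ ∷ w′) → Connected d (λ x → Before l x b′) b′ →
        ∃[ r ] Before (blocks f l) r (b′ ∷ w′) × Between (suc d) (b ∷ w) (b′ ∷ w′) r
      heads w′ w′∈ i (inj₁ e)           = ⊥-elim (e b j)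
      heads w′ w′∈ i (inj₂ (inj₁ d≡0)) = heads-0 i d≡0
      heads [] w′∈ i (inj₂ (inj₂ _)) = heads-0 i (sym (proj₁ (∈f⁻ b′∈ w′∈)))
      heads (c ∷ w″) w′∈ i (inj₂ (inj₂ (x , k , a))) with before? l c b′
      -- The exchange alters only the prefix of length one, and the one-letter prefix of `p` is also
      -- different, since `b ≢ b′`.
      ... | yes i′ = c ∷ b′ ∷ w″ ,
            before-blocks⁺ f i′ (∈f⁺ (before⇒∈ˡ i′) (proj₁ lc)
              ((proj₂ S≐ b′∈ , ~-sym (proj₂ (proj₁ (proj₂ lc)))) ,
               clique-mono w″ (λ ((s , e) , e′) → (s , e′) , e) (proj₂ (proj₂ lc)))) w′∈ ,
            0 , s≤s z≤n , [≢] (≢-heads j) , [≢] (≢-heads i′) ,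
            λ { zero _ _ → ≐-refl ; (suc zero) _ ne → ⊥-elim (ne refl) ; (suc (suc _)) _ _ → swap }
        where
        lc = ∈f⁻ b′∈ w′∈
        swap : ∀ {x y xs} → x ∷ y ∷ xs ≈ y ∷ x ∷ xs
        swap = sw , sw
          where
          sw : ∀ {x y xs z} → z ∈ x ∷ y ∷ xs → z ∈ y ∷ x ∷ xs
          sw (here e)          = there (here e)
          sw (there (here e))  = here e
          sw (there (there m)) = there (there m)
      ... | no ¬i′ =
        let c′ , p′ , p∈ , i₁ , a₁ , agree = restrict (subst (1 ≤_) (proj₁ (∈f⁻ b′∈ w′∈)) (s≤s z≤n)) j (before⇒∈ˡ i) w′∈ k a
            e , eq = f-link b′∈
        in descend b′∈ (subst (λ ws → Before ws (c′ ∷ p′) (c ∷ w″)) (sym eq)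
             (initial e (subst (λ ws → c′ ∷ p′ ∈ ws) eq p∈) (i₁ , a₁)
               (subst (λ ws → c ∷ w″ ∈ ws) eq w′∈) (¬i′ ∘ proj₁))) agree

-- Finite sets: covers and linear extensions of inclusion

∉-─ : ∀ {k} {p q : Subset k} {v} → v ∈ˢ p ─ q → v ∉ˢ q
∉-─ {p = inside ∷ p}  {outside ∷ q} Vec.here       ()
∉-─ {p = _ ∷ p}       {_ ∷ q}       (Vec.there v∈) (Vec.there v∈q) = ∉-─ {p = p} {q} v∈ v∈q

∣∪⁅⁆∣ : ∀ {k} (p : Subset k) v → v ∉ˢ p → ∣ p ∪ˢ ⁅ v ⁆ ∣ ≡ suc ∣ p ∣
∣∪⁅⁆∣ (inside  ∷ p) Fin.zero    v∉ = ⊥-elim (v∉ Vec.here)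
∣∪⁅⁆∣ (outside ∷ p) Fin.zero    v∉ = cong (suc ∘ ∣_∣) (∪-identityʳ p)
∣∪⁅⁆∣ (inside  ∷ p) (Fin.suc v) v∉ = cong suc (∣∪⁅⁆∣ p v (v∉ ∘ Vec.there))
∣∪⁅⁆∣ (outside ∷ p) (Fin.suc v) v∉ = ∣∪⁅⁆∣ p v (v∉ ∘ Vec.there)

module _ {n : ℕ} where

  private
    variable
      p q : Subset n
      v w : Fin n

  ∉-- : v ∉ˢ p - v
  ∉-- {v} {p} v∈ = ∉-─ {p = p} v∈ (x∈⁅x⁆ v)

  ∈-∪⁅⁆ : ∀ (p : Subset n) → v ∈ˢ p ∪ˢ ⁅ v ⁆
  ∈-∪⁅⁆ {v} p = q⊆p∪q p ⁅ v ⁆ (x∈⁅x⁆ v)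

  ∪⁅⁆⁻ : w ∈ˢ p ∪ˢ ⁅ v ⁆ → w ∈ˢ p ⊎ w ≡ v
  ∪⁅⁆⁻ {p = p} {v} m with x∈p∪q⁻ p ⁅ v ⁆ m
  ... | inj₁ m′ = inj₁ m′
  ... | inj₂ m′ = inj₂ (x∈⁅y⁆⇒x≡y _ m′)

  ∪⁅⁆-lub : p ⊆ˢ q → v ∈ˢ q → p ∪ˢ ⁅ v ⁆ ⊆ˢ q
  ∪⁅⁆-lub f v∈ m with ∪⁅⁆⁻ m
  ... | inj₁ m′   = f m′
  ... | inj₂ refl = v∈

  ⊂-∪⁅⁆ : v ∉ˢ p → p ⊂ p ∪ˢ ⁅ v ⁆
  ⊂-∪⁅⁆ {v} {p} v∉ = p⊆p∪q ⁅ v ⁆ , v , ∈-∪⁅⁆ p , v∉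

  -∪⁅⁆ : v ∈ˢ p → (p - v) ∪ˢ ⁅ v ⁆ ≡ p
  -∪⁅⁆ {v} {p} v∈ = ⊆-antisym (∪⁅⁆-lub (p─q⊆p p ⁅ v ⁆) v∈) f
    where
    f : p ⊆ˢ (p - v) ∪ˢ ⁅ v ⁆
    f {w} w∈ with w Fin.≟ v
    ... | yes refl = ∈-∪⁅⁆ (p - v)
    ... | no w≢v   = p⊆p∪q ⁅ v ⁆ (x∈p∧x≢y⇒x∈p-y w∈ w≢v)

  ∣-∣ : v ∈ˢ p → ∣ p ∣ ≡ suc ∣ p - v ∣
  ∣-∣ {v} {p} v∈ = trans (sym (cong ∣_∣ (-∪⁅⁆ v∈))) (∣∪⁅⁆∣ (p - v) v (∉-- {p = p}))

  ⊆⇒≡⊎⊂ : p ⊆ˢ q → p ≡ q ⊎ p ⊂ q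
  ⊆⇒≡⊎⊂ {p} {q} f with p ⊂? q
  ... | yes s = inj₂ s
  ... | no ¬s = inj₁ (⊆-antisym f g)
    where
    g : q ⊆ˢ p
    g {v} v∈ with v ∈ˢ? p
    ... | yes i = i
    ... | no ¬i = ⊥-elim (¬s (f , v , v∈ , ¬i))

  ⊆∧∣∣≤⇒≡ : p ⊆ˢ q → ∣ q ∣ ≤ ∣ p ∣ → p ≡ q
  ⊆∧∣∣≤⇒≡ f le with ⊆⇒≡⊎⊂ f
  ... | inj₁ e = e
  ... | inj₂ s = ⊥-elim (ℕ.<⇒≱ (p⊂q⇒∣p∣<∣q∣ s) le)

  no-between : ∀ {r : Subset n} → p ⊂ q → q ⊂ r → ¬ ∣ r ∣ ≡ suc ∣ p ∣
  no-between s s′ e = ℕ.<⇒≱ (p⊂q⇒∣p∣<∣q∣ s) (s≤s⁻¹ (ℕ.≤-trans (p⊂q⇒∣p∣<∣q∣ s′) (ℕ.≤-reflexive e)))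

  ⊂⇒∪⁅⁆⊆ : p ⊂ q → ∃[ v ] v ∉ˢ p × v ∈ˢ q × p ∪ˢ ⁅ v ⁆ ⊆ˢ q
  ⊂⇒∪⁅⁆⊆ (f , v , v∈ , v∉) = v , v∉ , v∈ , ∪⁅⁆-lub f v∈

  cover⇒∪⁅⁆ : p ⊂ q → ∣ q ∣ ≡ suc ∣ p ∣ → ∃[ v ] v ∉ˢ p × q ≡ p ∪ˢ ⁅ v ⁆
  cover⇒∪⁅⁆ {p} s e = let v , v∉ , _ , f = ⊂⇒∪⁅⁆⊆ s in
    v , v∉ , sym (⊆∧∣∣≤⇒≡ f (ℕ.≤-reflexive (trans e (sym (∣∪⁅⁆∣ p v v∉)))))

  cover⇒- : p ⊂ q → ∣ q ∣ ≡ suc ∣ p ∣ → ∃[ v ] v ∉ˢ p × v ∈ˢ q × p ≡ q - v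
  cover⇒- {p} {q} (f , v , v∈ , v∉) e =
    v , v∉ , v∈ , ⊆∧∣∣≤⇒≡ (λ m → x∈p∧x≢y⇒x∈p-y (f m) λ { refl → v∉ m })
      (ℕ.≤-reflexive (suc-injective (trans (sym (∣-∣ v∈)) e)))

subsets : ∀ n → List (Subset n)
subsets zero    = [] ∷ []
subsets (suc n) = map (inside ∷_) (subsets n) ++ map (outside ∷_) (subsets n)

∈-subsets : ∀ {n} (p : Subset n) → p ∈ subsets n
∈-subsets []            = here refl
∈-subsets (inside ∷ p)  = ∈-++⁺ˡ (∈-map⁺ _ (∈-subsets p))
∈-subsets {suc n} (outside ∷ p) = ∈-++⁺ʳ (map (inside ∷_) (subsets n)) (∈-map⁺ _ (∈-subsets p))

-- Read from the end, such a list reaches every set after all listed subsets of it. Repetitions are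
-- excluded as well.
Decreasing : ∀ {n} → List (Subset n) → Set
Decreasing = AllPairs λ p q → ¬ p ⊆ˢ q

subsets-decreasing : ∀ n → Decreasing (subsets n)
subsets-decreasing zero    = [] ∷ []
subsets-decreasing (suc n) = AllPairs.++⁺
  (AllPairs.map⁺ (AllPairs.map ∷-⊈ (subsets-decreasing n)))
  (AllPairs.map⁺ (AllPairs.map ∷-⊈ (subsets-decreasing n)))
  (All.map⁺ (All.universal (λ p → All.map⁺ (All.universal (λ q → inside-⊈ p q) _)) (subsets n)))
  where
  inside-⊈ : ∀ {n} (p q : Subset n) → ¬ inside ∷ p ⊆ˢ outside ∷ q
  inside-⊈ p q f with () ← f Vec.here
  ∷-⊈ : ∀ {n s} {p q : Subset n} → ¬ p ⊆ˢ q → ¬ s ∷ p ⊆ˢ s ∷ q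
  ∷-⊈ f g = f (drop-∷-⊆ g)

-- From expansions to tame orders

module _ {n : ℕ} where

  infix 4 _~_
  _~_ : Subset n → Subset n → Set
  p ~ q = p ⊂ q ⊎ q ⊂ p

  ~-sym : ∀ {p q} → p ~ q → q ~ p
  ~-sym (inj₁ s) = inj₂ s
  ~-sym (inj₂ s) = inj₁ s

  ~-irrefl : ∀ {p} → ¬ p ~ p
  ~-irrefl (inj₁ s) = ⊂-irref refl s
  ~-irrefl (inj₂ s) = ⊂-irref refl s

  open Orderings _~_ ~-sym (λ {p} → ~-irrefl {p}) public

  Upper : Set′ → Subset n → Set′
  Upper F σ ρ = σ ⊂ ρ × F ρ

  Interval : Subset n → Subset n → Set′
  Interval σ τ ρ = σ ⊂ ρ × ρ ⊂ τ

  -- What is present after the reverses of the elementary collapses of the pairs,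
  -- the last of which is at the head of the list, starting from the single face x.
  Present : Subset n → List (Subset n × Subset n) → Set′
  Present x []             = ｛ x ｝
  Present x ((s , t) ∷ ps) = (Present x ps ∪ ｛ t ｝) ∪ ｛ s ｝

  -- This reverses an elementary collapse in the link of `σ`, with faces written as supersets of
  -- `σ`. That `t` is the only face above `s` is not a field: it follows from `s∉E`, because the
  -- sets that arise are closed downwards. `below` says that all other proper faces of `t` are
  -- present.
  record Expands (F : Set′) (σ : Subset n) (E : Set′) (s t : Subset n) : Set where
    field
      s∉E   : ¬ E s
      t∉E   : ¬ E t
      σ⊂s   : σ ⊂ s
      s⊂t   : s ⊂ t
      t∈F   : F t
      cover : ∣ t ∣ ≡ suc ∣ s ∣
      below : ∀ {ρ} → σ ⊂ ρ → ρ ⊂ t → ρ ≡ s ⊎ E ρ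

    σ⊂t : σ ⊂ t
    σ⊂t = ⊂-trans σ⊂s s⊂t

  Expansion : Set′ → Subset n → Subset n → List (Subset n × Subset n) → Set
  Expansion F σ x []             = σ ⊂ x × ∣ x ∣ ≡ suc ∣ σ ∣ × F x
  Expansion F σ x ((s , t) ∷ ps) = Expansion F σ x ps × Expands F σ (Present x ps) s t

  present? : ∀ x ps → Decidable (Present x ps)
  present? x []             p = x ≟ˢ p
  present? x ((s , t) ∷ ps) p = (present? x ps p ⊎-dec (t ≟ˢ p)) ⊎-dec (s ≟ˢ p)

  module _ {F : Set′} (F-closed : ∀ {ρ τ} → ρ ⊆ˢ τ → F τ → F ρ) {σ x : Subset n} where

    present⇒upper : ∀ ps → Expansion F σ x ps → Present x ps ⊆ Upper F σ
    present⇒upper [] (s , _ , f) refl = s , f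
    present⇒upper (_ ∷ ps) (ex , e) (inj₁ (inj₁ m)) = present⇒upper ps ex m
    present⇒upper (_ ∷ ps) (ex , e) (inj₁ (inj₂ refl)) = Expands.σ⊂t e , Expands.t∈F e
    present⇒upper (_ ∷ ps) (ex , e) (inj₂ refl) = Expands.σ⊂s e , F-closed (p⊂q⇒p⊆q (Expands.s⊂t e)) (Expands.t∈F e)

    present-closed : ∀ ps → Expansion F σ x ps → ∀ {ρ τ} → Present x ps τ → σ ⊂ ρ → ρ ⊂ τ → Present x ps ρ
    present-closed [] (_ , e , _) refl s s′ =
      ⊥-elim (no-between s s′ e)
    present-closed (_ ∷ ps) (ex , e) (inj₁ (inj₁ m)) s s′ = inj₁ (inj₁ (present-closed ps ex m s s′))
    present-closed (_ ∷ ps) (ex , e) (inj₁ (inj₂ refl)) s s′ with Expands.below e s s′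
    ... | inj₁ refl = inj₂ refl
    ... | inj₂ m    = inj₁ (inj₁ m)
    present-closed (_ ∷ ps) (ex , e) (inj₂ refl) s s′ with Expands.below e s (⊂-trans s′ (Expands.s⊂t e))
    ... | inj₁ refl = ⊥-elim (⊂-irref refl s′)
    ... | inj₂ m    = inj₁ (inj₁ m)

  -- The face `t` goes first: if `s` did, it would be attached along the whole interval below it, a
  -- sphere, with nothing present above to cone it off.
  body : List (Subset n × Subset n) → List (Subset n)
  body []             = []
  body ((s , t) ∷ ps) = body ps ++ t ∷ s ∷ []

  present-body : ∀ x ps → Present x ps ≐ (｛ x ｝ ∪ (_∈ body ps))
  present-body x [] = inj₁ , λ { (inj₁ e) → e }
  present-body x ((s , t) ∷ ps) = ≐-trans (∪-cong (∪-cong (present-body x ps) ≐-refl) ≐-refl)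
    ((λ { (inj₁ (inj₁ (inj₁ e))) → inj₁ e ; (inj₁ (inj₁ (inj₂ m))) → inj₂ (∈-++⁺ˡ m)
        ; (inj₁ (inj₂ refl)) → inj₂ (∈-++⁺ʳ (body ps) (here refl))
        ; (inj₂ refl) → inj₂ (∈-++⁺ʳ (body ps) (there (here refl))) }) ,
     λ { (inj₁ e) → inj₁ (inj₁ (inj₁ e)) ; (inj₂ m) → split (∈-++⁻ (body ps) m) })
    where
    split : ∀ {ρ} → ρ ∈ body ps ⊎ ρ ∈ t ∷ s ∷ [] → ((((｛ x ｝ ∪ (_∈ body ps)) ∪ ｛ t ｝) ∪ ｛ s ｝)) ρ
    split (inj₁ m)                   = inj₁ (inj₁ (inj₂ m))
    split (inj₂ (here refl))         = inj₁ (inj₂ refl)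
    split (inj₂ (there (here refl))) = inj₂ refl

  tame-root : ∀ d {W S} (t : Tame (suc d) W S) → Tame (suc d) ｛ proj₁ t ｝ S
  tame-root d (a , l₁ , l₂ , w , s , g , st₁ , st₂) =
    a , [] , l₁ ++ l₂ , ((λ { refl → here refl }) , λ { (here refl) → refl }) , s , g , tt ,
    steps-resp (l₁ ++ l₂) (goodStep-resp d) ((λ { refl → here refl }) , λ { (here refl) → refl })
      (steps-++ l₁ (goodStep-resp d) ∷-≐
        (map-steps ∅ l₁ (≐-sym ∪-∅)
          (λ _ eq st → goodStep-resp d (≐-sym (≐-trans eq ∪-∅)) (tameStep⇒goodStep d st)) st₁)
        st₂)

  -- The vertices of sd(lk σ) that are comparable with τ form the join of the
  -- interval below τ and of Upper F τ; joining the ranks of the two pieces gives d.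
  module _ {F : Set′} (F-closed : ∀ {ρ τ} → ρ ⊆ˢ τ → F τ → F ρ)
    {D : ℕ} (F-bound : ∀ {τ} → F τ → ∣ τ ∣ ≤ D)
    {σ : Subset n} {d : ℕ} (∣σ∣ : ∣ σ ∣ + suc d ≡ D)
    (lower-tame : ∀ {s t} → σ ⊂ s → s ⊂ t → F t → ∣ t ∣ ≡ suc ∣ s ∣ → ∀ k → ∣ t ∣ ≡ ∣ σ ∣ + suc k →
      Tame k (Interval σ t ∩ (_≢ s)) (Interval σ t))
    (lower-good : ∀ {t} → σ ⊂ t → F t → ∀ k → ∣ t ∣ ≡ ∣ σ ∣ + suc k → Good k (Interval σ t) (Interval σ t))
    (upper-tame : ∀ {s t} → σ ⊂ s → s ⊂ t → F t → ∣ t ∣ ≡ suc ∣ s ∣ → ∀ m → ∣ s ∣ + m ≡ D →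
      Tame m ｛ t ｝ (Upper F s))
    (upper-good : ∀ {t} → σ ⊂ t → F t → ∀ m → ∣ t ∣ + m ≡ D → Good m ∅ (Upper F t))
    where

    private
      S : Set′
      S = Upper F σ

      ranks : ∀ {t} → σ ⊂ t → F t → ∃[ k ] ∃[ m ] ∣ t ∣ ≡ ∣ σ ∣ + suc k × ∣ t ∣ + m ≡ D × k + m ≡ d
      ranks {t} s f = let k , e = ℕ.m≤n⇒∃[o]m+o≡n (p⊂q⇒∣p∣<∣q∣ s)
                          m , e′ = ℕ.m≤n⇒∃[o]m+o≡n (F-bound f)
                          e″ = trans (sym e) (sym (+-suc ∣ σ ∣ k)) in
        k , m , e″ , e′ ,
        suc-injective (ℕ.+-cancelˡ-≡ ∣ σ ∣ (suc (k + m)) (suc d)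
          (trans (sym (ℕ.+-assoc ∣ σ ∣ (suc k) m)) (trans (cong (_+ m) (sym e″)) (trans e′ (sym ∣σ∣)))))

      S∩N : ∀ {t} → σ ⊂ t → F t → (S ∩ N t) ≐ (Interval σ t ∪ Upper F t)
      S∩N s f =
        (λ { ((a , b) , inj₁ c) → inj₁ (a , c) ; ((a , b) , inj₂ c) → inj₂ (c , b) }) ,
        (λ { (inj₁ (a , c)) → (a , F-closed (p⊂q⇒p⊆q c) f) , inj₁ c
           ; (inj₂ (c , b)) → (⊂-trans s c , b) , inj₂ c })

      adjacent : ∀ {t} → Adjacent (Interval σ t) (Upper F t)
      adjacent (_ , a) (b , _) = inj₁ (⊂-trans a b)

      cast : ∀ {d d′ W S} → d ≡ d′ → Tame d W S → Tame d′ W S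
      cast refl t = t

    module _ {x : Subset n} where

      private
        -- A present face above `t` would force `t` to be present. So the upper factor contributes
        -- the empty initial segment, and tameness comes from the lower factor alone.
        step-t : ∀ ps → Expansion F σ x ps → ∀ {s t} → Expands F σ (Present x ps) s t →
          TameStep d S (Present x ps) t
        step-t ps ex {s} {t} e = t∉E ,
          (let k , m , e₁ , e₂ , e₃ = ranks σ⊂t t∈F in
           tame-resp d
             ((λ { (inj₁ ((a , b) , c)) → present a b c , inj₁ b }) , λ (a , b) → inj₁ (down a b))
             (≐-sym (S∩N σ⊂t t∈F))
             (cast e₃ (tame-join k m adjacent (lower-tame σ⊂s s⊂t t∈F cover k e₁) (upper-good σ⊂t t∈F m e₂))))
          where
          open Expands e
          present : ∀ {ρ} → σ ⊂ ρ → ρ ⊂ t → ρ ≢ s → Present x ps ρ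
          present a b c with below a b
          ... | inj₁ eq = ⊥-elim (c eq)
          ... | inj₂ i  = i
          down : ∀ {ρ} → Present x ps ρ → ρ ~ t → (Interval σ t ∩ (_≢ s)) ρ
          down a (inj₁ b) = (proj₁ (present⇒upper F-closed ps ex a) , b) , λ { refl → s∉E a }
          down a (inj₂ b) = ⊥-elim (t∉E (present-closed F-closed ps ex a σ⊂t b))

        -- The tame factor is now the upper one, with `t` alone present, so the join is taken in the
        -- opposite order.
        step-s : ∀ ps → Expansion F σ x ps → ∀ {s t} → Expands F σ (Present x ps) s t →
          TameStep d S (Present x ps ∪ ｛ t ｝) s
        step-s ps ex {s} {t} e = (λ { (inj₁ i) → s∉E i ; (inj₂ refl) → ⊂-irref refl s⊂t }) ,
          (let k , m , e₁ , e₂ , e₃ = ranks σ⊂s s∈F in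
           tame-resp d
             ((λ { (inj₁ refl) → inj₂ refl , inj₂ s⊂t ; (inj₂ (a , b)) → inj₁ (present a b) , inj₁ b }) ,
              λ (a , b) → back a b)
             (≐-trans ∪-comm (≐-sym (S∩N σ⊂s s∈F)))
             (cast (trans (+-comm m k) e₃)
               (tame-join m k (λ a b → ~-sym (adjacent b a)) (upper-tame σ⊂s s⊂t t∈F cover m e₂)
                 (lower-good σ⊂s s∈F k e₁))))
          where
          open Expands e
          s∈F : F s
          s∈F = F-closed (p⊂q⇒p⊆q s⊂t) t∈F
          present : ∀ {ρ} → σ ⊂ ρ → ρ ⊂ s → Present x ps ρ
          present a b with below a (⊂-trans b s⊂t)
          ... | inj₁ refl = ⊥-elim (⊂-irref refl b)
          ... | inj₂ i    = i
          back : ∀ {ρ} → (Present x ps ∪ ｛ t ｝) ρ → ρ ~ s → (｛ t ｝ ∪ Interval σ s) ρ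
          back (inj₂ refl) _    = inj₁ refl
          back (inj₁ i) (inj₁ b) = inj₂ (proj₁ (present⇒upper F-closed ps ex i) , b)
          back (inj₁ i) (inj₂ b) = ⊥-elim (s∉E (present-closed F-closed ps ex i σ⊂s b))

        steps-body : ∀ ps → Expansion F σ x ps → Steps (TameStep d S) ｛ x ｝ (body ps)
        steps-body []             _        = tt
        steps-body ((s , t) ∷ ps) (ex , e) = steps-++ (body ps) (tameStep-resp d) (present-body x ps)
          (steps-body ps ex) (step-t ps ex e , step-s ps ex e , tt)

      module _ (ps : List (Subset n × Subset n)) (ex : Expansion F σ x ps)
        (F? : Decidable F) (rest : ∀ {ρ} → Upper F σ ρ → ¬ Present x ps ρ → ∣ ρ ∣ ≡ D) where

        private
          Missing : Set′
          Missing ρ = Upper F σ ρ × ¬ Present x ps ρ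

          missing? : Decidable Missing
          missing? ρ = ((σ ⊂? ρ) ×-dec F? ρ) ×-dec ¬? (present? x ps ρ)

          -- A missing face has the full size `D`. Its proper faces are smaller, hence all present,
          -- and nothing lies above it: it is attached along its whole link.
          step-rest : ∀ {E φ} → Missing φ → Present x ps ⊆ E → E ⊆ S → ¬ E φ → GoodStep d S E φ
          step-rest {E} {φ} ((a , f) , m) i j ne = ne , connected d refl , good-resp d
            ((λ (a , b) → i (proj₁ (lower a b)) , inj₁ b) , λ (e , c) → interval (j e) c)
            ((λ (a , b) → proj₂ (lower a b) , inj₁ b) , λ (e , c) → interval e c)
            (lower-good a f d ∣φ∣)
            where
            ∣φ∣ : ∣ φ ∣ ≡ ∣ σ ∣ + suc d
            ∣φ∣ = trans (rest (a , f) m) (sym ∣σ∣)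
            lower : ∀ {ρ} → σ ⊂ ρ → ρ ⊂ φ → Present x ps ρ × S ρ
            lower {ρ} s s′ with present? x ps ρ
            ... | yes p = p , present⇒upper F-closed ps ex p
            ... | no ¬p = ⊥-elim (ℕ.<-irrefl (trans (rest ρ∈S ¬p) (sym (rest (a , f) m))) (p⊂q⇒∣p∣<∣q∣ s′))
              where
              ρ∈S : S ρ
              ρ∈S = s , F-closed (p⊂q⇒p⊆q s′) f
            interval : ∀ {ρ} → S ρ → ρ ~ φ → Interval σ φ ρ
            interval (s , _) (inj₁ c) = s , c
            interval (s , f′) (inj₂ c) = ⊥-elim (ℕ.<⇒≱ (p⊂q⇒∣p∣<∣q∣ c)
              (ℕ.≤-trans (F-bound f′) (ℕ.≤-reflexive (sym (rest (a , f) m)))))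
            connected : ∀ d′ → d ≡ d′ → Connected d E φ
            connected zero     e    = inj₂ (inj₁ e)
            connected (suc d′) refl with good-satisfiable d (lower-good a f d ∣φ∣)
            ... | inj₁ (ρ , s , s′) = inj₂ (inj₂ (ρ , i (proj₁ (lower s s′)) , inj₁ s′))

          steps-rest : ∀ l {E} → Decreasing l → (∀ {φ} → φ ∈ l → Missing φ × ¬ E φ) →
            Present x ps ⊆ E → E ⊆ S → Steps (GoodStep d S) E l
          steps-rest []      _         _ _ _ = tt
          steps-rest (φ ∷ l) (a ∷ as) f i j =
            step-rest (proj₁ (f (here refl))) i j (proj₂ (f (here refl))) ,
            steps-rest l as
              (λ m → proj₁ (f (there m)) , λ { (inj₁ e) → proj₂ (f (there m)) e ; (inj₂ refl) → All.lookup a m id })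
              (inj₁ ∘ i) (λ { (inj₁ e) → j e ; (inj₂ refl) → proj₁ (proj₁ (f (here refl))) })

          missing : List (Subset n)
          missing = filter missing? (subsets n)

          built : ∃[ l₁ ] ∃[ l₂ ] Present x ps ≐ (_∈ x ∷ l₁) × S ≐ (_∈ x ∷ l₁ ++ l₂) ×
            Good d ∅ (S ∩ N x) × Steps (TameStep d S) ｛ x ｝ l₁ × Steps (GoodStep d S) (_∈ x ∷ l₁) l₂
          built = body ps , missing , E≐ ,
            ≐-trans ((λ {ρ} s → to s (present? x ps ρ)) , from)
              (≐-trans (∪-cong E≐ ≐-refl) (≐-sym (++-≐ (x ∷ body ps)))) ,
            link-x ps ex , steps-body ps ex ,
            steps-resp missing (goodStep-resp d) E≐
              (steps-rest missing (AllPairs.filter⁺ missing? (subsets-decreasing n))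
                (λ m → let i = proj₂ (∈-filter⁻ missing? {xs = subsets n} m) in i , proj₂ i) id
                (present⇒upper F-closed ps ex))
            where
            E≐ = ≐-trans (present-body x ps) (≐-sym ∷-≐)
            to : ∀ {ρ} → S ρ → Dec (Present x ps ρ) → (Present x ps ∪ (_∈ missing)) ρ
            to s (yes p) = inj₁ p
            to s (no ¬p) = inj₂ (∈-filter⁺ missing? (∈-subsets _) (s , ¬p))
            from : (Present x ps ∪ (_∈ missing)) ⊆ S
            from (inj₁ p) = present⇒upper F-closed ps ex p
            from (inj₂ m) = proj₁ (proj₂ (∈-filter⁻ missing? {xs = subsets n} m))
            link-x : ∀ ps → Expansion F σ x ps → Good d ∅ (S ∩ N x)
            link-x (_ ∷ ps) (ex , _) = link-x ps ex
            link-x [] (s , e , f) = good-resp d ≐-refl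
              (≐-trans (inj₂ , λ { (inj₁ (s₁ , s₂)) → ⊥-elim (no-between s₁ s₂ e) ; (inj₂ u) → u })
                (≐-sym (S∩N s f)))
              (upper-good s f d (trans (cong (_+ d) e) (trans (sym (+-suc ∣ σ ∣ d)) ∣σ∣)))

        -- The first component serves for the boundary of a simplex minus a facet, the second where
        -- only the starting face is prescribed.
        expansion⇒tame : Tame (suc d) (Present x ps) S × Tame (suc d) ｛ x ｝ S
        expansion⇒tame = (x , built) , tame-root d {Present x ps} (x , built)

-- Intervals in the Boolean lattice

module _ {n : ℕ} where

  private
    variable
      p q : Subset n
      v : Fin n

  -⊂- : p ⊂ q → v ∈ˢ p → p - v ⊂ q - v
  -⊂- {p} {q} {v} (f , w , w∈ , w∉) v∈ =
    (λ m → x∈p∧x≢y⇒x∈p-y (f (p─q⊆p p ⁅ v ⁆ m)) λ { refl → ∉-- {p = p} m }) ,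
    w , x∈p∧x≢y⇒x∈p-y w∈ (λ { refl → w∉ v∈ }) , w∉ ∘ p─q⊆p p ⁅ v ⁆

  ∪⁅⁆- : v ∉ˢ p → (p ∪ˢ ⁅ v ⁆) - v ≡ p
  ∪⁅⁆- {v} {p} v∉ = ⊆-antisym f (λ m → x∈p∧x≢y⇒x∈p-y (p⊆p∪q ⁅ v ⁆ m) λ { refl → v∉ m })
    where
    f : (p ∪ˢ ⁅ v ⁆) - v ⊆ˢ p
    f m with ∪⁅⁆⁻ {p = p} (p─q⊆p (p ∪ˢ ⁅ v ⁆) ⁅ v ⁆ m)
    ... | inj₁ m′   = m′
    ... | inj₂ refl = ⊥-elim (∉-- {p = p ∪ˢ ⁅ v ⁆} m)

  ⊆- : p ⊆ˢ q → v ∉ˢ p → p ⊆ˢ q - v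
  ⊆- f v∉ m = x∈p∧x≢y⇒x∈p-y (f m) λ { refl → v∉ m }

  -- The boundary of the simplex τ minus its face τ - v collapses onto the
  -- vertex v through the pairs (c , c ∪ ⁅ v ⁆), and similarly above σ.
  module Cone {σ τ : Subset n} {v : Fin n} (v∈τ : v ∈ˢ τ) (v∉σ : v ∉ˢ σ)
    (σ⊂τ : σ ⊂ τ) (x⊂τ : σ ∪ˢ ⁅ v ⁆ ⊂ τ) where

    x : Subset n
    x = σ ∪ˢ ⁅ v ⁆

    pairs : List (Subset n) → List (Subset n × Subset n)
    pairs = map λ c → c , c ∪ˢ ⁅ v ⁆

    present⁻ : ∀ cs {ρ} → Present x (pairs cs) ρ → ρ ≡ x ⊎ ∃[ c ] c ∈ cs × (ρ ≡ c ⊎ ρ ≡ c ∪ˢ ⁅ v ⁆)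
    present⁻ []       refl               = inj₁ refl
    present⁻ (c ∷ cs) (inj₂ refl)        = inj₂ (c , here refl , inj₁ refl)
    present⁻ (c ∷ cs) (inj₁ (inj₂ refl)) = inj₂ (c , here refl , inj₂ refl)
    present⁻ (c ∷ cs) (inj₁ (inj₁ p)) with present⁻ cs p
    ... | inj₁ e            = inj₁ e
    ... | inj₂ (c , m , e) = inj₂ (c , there m , e)

    present-x : ∀ cs → Present x (pairs cs) x
    present-x []       = refl
    present-x (c ∷ cs) = inj₁ (inj₁ (present-x cs))

    present⁺ : ∀ {cs c} → c ∈ cs → Present x (pairs cs) c × Present x (pairs cs) (c ∪ˢ ⁅ v ⁆)
    present⁺ (here refl) = inj₂ refl , inj₁ (inj₂ refl)
    present⁺ (there m)   = let a , b = present⁺ m in inj₁ (inj₁ a) , inj₁ (inj₁ b)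

    -- Removing `v` from `ρ` leaves either `σ`, and then `ρ` is the root, or a listed `c`, and then
    -- `ρ` is the upper member of its pair.
    present-below : ∀ cs {ρ q} → σ ⊂ ρ → ρ ⊂ q → v ∈ˢ ρ → (∀ {c} → σ ⊂ c → c ⊂ q - v → c ∈ cs) →
      Present x (pairs cs) ρ
    present-below cs {ρ} s s′ v∈ f with ⊆⇒≡⊎⊂ (⊆- (p⊂q⇒p⊆q s) v∉σ)
    ... | inj₁ e  = subst (Present x (pairs cs)) (trans (cong (_∪ˢ ⁅ v ⁆) e) (-∪⁅⁆ v∈)) (present-x cs)
    ... | inj₂ s″ = subst (Present x (pairs cs)) (-∪⁅⁆ v∈) (proj₂ (present⁺ (f s″ (-⊂- s′ v∈))))

    -- Closure under smaller faces passes to the tail, because the head of a decreasing list is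
    -- contained in no later entry. The head pair is the one inserted last.
    expand : ∀ cs → Decreasing cs → (∀ {c} → c ∈ cs → Interval σ (τ - v) c) →
      (∀ {c c′} → c ∈ cs → σ ⊂ c′ → c′ ⊂ c → c′ ∈ cs) → Expansion (_⊂ τ) σ x (pairs cs)
    expand [] _ _ _ = ⊂-∪⁅⁆ v∉σ , ∣∪⁅⁆∣ σ v v∉σ , x⊂τ
    expand (c ∷ cs) (a ∷ as) f g =
      expand cs as (f ∘ there) (λ m s s′ → tail m s s′ (g (there m) s s′)) , record
        { s∉E   = s∉
        ; t∉E   = t∉
        ; σ⊂s   = σ⊂c
        ; s⊂t   = ⊂-∪⁅⁆ v∉c
        ; t∈F   = let h , w , w∈ , w∉ = c⊂ in
                  ∪⁅⁆-lub (p─q⊆p τ ⁅ v ⁆ ∘ h) v∈τ , w , p─q⊆p τ ⁅ v ⁆ w∈ ,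
                  λ m → w∉∪ w∈ w∉ (∪⁅⁆⁻ m)
        ; cover = ∣∪⁅⁆∣ c v v∉c
        ; below = λ {ρ} → below ρ
        }
      where
      σ⊂c = proj₁ (f (here refl))
      c⊂ = proj₂ (f (here refl))
      v∉ : ∀ {c′} → c′ ∈ c ∷ cs → v ∉ˢ c′
      v∉ m v∈ = ∉-- {p = τ} (p⊂q⇒p⊆q (proj₂ (f m)) v∈)
      v∉c = v∉ (here refl)
      w∉∪ : ∀ {w} → w ∈ˢ τ - v → w ∉ˢ c → ¬ (w ∈ˢ c ⊎ w ≡ v)
      w∉∪ w∈ w∉ (inj₁ m)    = w∉ m
      w∉∪ w∈ w∉ (inj₂ refl) = ∉-- {p = τ} w∈
      tail : ∀ {c₁ c₂} → c₁ ∈ cs → σ ⊂ c₂ → c₂ ⊂ c₁ → c₂ ∈ c ∷ cs → c₂ ∈ cs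
      tail m s s′ (here refl) = ⊥-elim (All.lookup a m (p⊂q⇒p⊆q s′))
      tail m s s′ (there m′)  = m′
      s∉ : ¬ Present x (pairs cs) c
      s∉ p with present⁻ cs p
      ... | inj₁ e                 = v∉c (subst (v ∈ˢ_) (sym e) (∈-∪⁅⁆ σ))
      ... | inj₂ (_ , m , inj₁ refl) = All.lookup a m ⊆-refl
      ... | inj₂ (c′ , m , inj₂ e) = v∉c (subst (v ∈ˢ_) (sym e) (∈-∪⁅⁆ c′))
      c∪⊆ : ∀ {c′} → c ∪ˢ ⁅ v ⁆ ≡ c′ ∪ˢ ⁅ v ⁆ → c ⊆ˢ c′
      c∪⊆ {c′} e m with ∪⁅⁆⁻ {p = c′} (subst (_ ∈ˢ_) e (p⊆p∪q ⁅ v ⁆ m))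
      ... | inj₁ m′   = m′
      ... | inj₂ refl = ⊥-elim (v∉c m)
      t∉ : ¬ Present x (pairs cs) (c ∪ˢ ⁅ v ⁆)
      t∉ p with present⁻ cs p
      ... | inj₁ e                 = ⊂-irref refl (⊂-⊆-trans σ⊂c (c∪⊆ e))
      ... | inj₂ (c′ , m , inj₁ e) = v∉ (there m) (subst (v ∈ˢ_) e (∈-∪⁅⁆ c))
      ... | inj₂ (c′ , m , inj₂ e) = All.lookup a m (c∪⊆ e)
      below : ∀ ρ → σ ⊂ ρ → ρ ⊂ c ∪ˢ ⁅ v ⁆ → ρ ≡ c ⊎ Present x (pairs cs) ρ
      below ρ s s′ with v ∈ˢ? ρ
      ... | yes v∈ = inj₂ (present-below cs s s′ v∈ λ {c′} r r′ →
            let r″ = subst (c′ ⊂_) (∪⁅⁆- v∉c) r′ in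
            tail′ r r″)
        where
        tail′ : ∀ {c′} → σ ⊂ c′ → c′ ⊂ c → c′ ∈ cs
        tail′ r r′ with g (here refl) r r′
        ... | here refl = ⊥-elim (⊂-irref refl r′)
        ... | there m   = m
      ... | no ρ∌v with ⊆⇒≡⊎⊂ (λ {w} m → subst (w ∈ˢ_) (∪⁅⁆- v∉c) (⊆- (p⊂q⇒p⊆q s′) ρ∌v m))
      ...   | inj₁ e  = inj₁ e
      ...   | inj₂ s″ with g (here refl) s s″
      ...     | here e  = inj₁ e
      ...     | there m = inj₂ (proj₁ (present⁺ m))

    interval? : Decidable (Interval σ (τ - v))
    interval? c = (σ ⊂? c) ×-dec (c ⊂? (τ - v))

    faces : List (Subset n)
    faces = filter interval? (subsets n)

    faces⁻ : ∀ {c} → c ∈ faces → Interval σ (τ - v) c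
    faces⁻ m = proj₂ (∈-filter⁻ interval? {xs = subsets n} m)

    faces⁺ : ∀ {c} → Interval σ (τ - v) c → c ∈ faces
    faces⁺ = ∈-filter⁺ interval? (∈-subsets _)

    expansion : Expansion (_⊂ τ) σ x (pairs faces)
    expansion = expand faces (AllPairs.filter⁺ interval? (subsets-decreasing n)) faces⁻
      λ m s s′ → faces⁺ (s , ⊂-trans s′ (proj₂ (faces⁻ m)))

    present≐ : Present x (pairs faces) ≐ (Interval σ τ ∩ (_≢ τ - v))
    present≐ = (λ {ρ} p → present⇒upper ⊆-⊂-trans (pairs faces) expansion p , ≢-base p) , to
      where
      ≢-base : ∀ {ρ} → Present x (pairs faces) ρ → ρ ≢ τ - v
      ≢-base p e with present⁻ faces p
      ... | inj₁ refl                = ∉-- {p = τ} (subst (v ∈ˢ_) e (∈-∪⁅⁆ σ))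
      ... | inj₂ (c , m , inj₁ refl) = ⊂-irref e (proj₂ (faces⁻ m))
      ... | inj₂ (c , m , inj₂ refl) = ∉-- {p = τ} (subst (v ∈ˢ_) e (∈-∪⁅⁆ c))
      to : (Interval σ τ ∩ (_≢ τ - v)) ⊆ Present x (pairs faces)
      to {ρ} ((s , s′) , ne) with v ∈ˢ? ρ
      ... | yes v∈ = present-below faces s s′ v∈ (λ r r′ → faces⁺ (r , r′))
      ... | no v∉ with ⊆⇒≡⊎⊂ (⊆- (p⊂q⇒p⊆q s′) v∉)
      ...   | inj₁ e  = ⊥-elim (ne e)
      ...   | inj₂ s″ = proj₁ (present⁺ (faces⁺ (s , s″)))

  -- These fields are what `expansion⇒tame` asks of the intervals below a face and, inside a single
  -- simplex, of those above it. The rank `k` is the length of the maximal chains of the open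
  -- interval.
  record Boolean (k : ℕ) (σ τ : Subset n) : Set where
    field
      good       : Good k (Interval σ τ) (Interval σ τ)
      tame-facet : ∀ {s} → σ ⊂ s → s ⊂ τ → ∣ τ ∣ ≡ suc ∣ s ∣ → Tame k (Interval σ τ ∩ (_≢ s)) (Interval σ τ)
      tame-point : ∀ {x} → σ ⊂ x → x ⊂ τ → ∣ x ∣ ≡ suc ∣ σ ∣ → Tame k ｛ x ｝ (Interval σ τ)

  private
    rank-< : ∀ {p q : Subset n} a {j k} → p ⊂ q → ∣ p ∣ ≡ a + j → ∣ q ∣ ≡ a + k → j < k
    rank-< a s e e′ = ℕ.+-cancelˡ-< a _ _
      (ℕ.≤-trans (ℕ.≤-trans (ℕ.≤-reflexive (cong suc (sym e))) (p⊂q⇒∣p∣<∣q∣ s)) (ℕ.≤-reflexive e′))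

  corank-< : ∀ {p q : Subset n} {j k D} → p ⊂ q → ∣ p ∣ + j ≡ D → ∣ q ∣ + k ≡ D → k < j
  corank-< {p} {q} {j} {k} s e e′ with k ℕ.<? j
  ... | yes l = l
  ... | no ¬l = ⊥-elim (ℕ.<-irrefl (trans e (sym e′)) (ℕ.+-mono-<-≤ (p⊂q⇒∣p∣<∣q∣ s) (ℕ.≮⇒≥ ¬l)))

  -- One cone with apex `v` yields both tame fields: its only missing face is `τ - v`, and its root
  -- is `σ ∪ˢ ⁅ v ⁆`. Every facet and every point of the interval arises from such a `v`. The bound
  -- `N` makes the recursion structural, as intervals on both sides of a face are needed.
  boolean : ∀ N k → k < N → ∀ {σ τ : Subset n} → σ ⊂ τ → ∣ τ ∣ ≡ ∣ σ ∣ + suc k → Boolean k σ τ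
  boolean (suc N) zero _ {σ} {τ} σ⊂τ e = record
    { good       = (λ _ (a , b) → none a b) , λ _ (a , b) → none a b
    ; tame-facet = λ s s′ → ⊥-elim (none s s′)
    ; tame-point = λ s s′ → ⊥-elim (none s s′)
    }
    where
    none : ∀ {ρ} → σ ⊂ ρ → ρ ⊂ τ → ⊥
    none a b = no-between a b (trans e (+-comm ∣ σ ∣ 1))
  boolean (suc N) (suc d) (s≤s d<N) {σ} {τ} σ⊂τ@(_ , w , w∈ , w∉) e = record
    { good       = good-all (suc d) (tame⇒good (suc d) (proj₁ (cone w∈ w∉)))
    ; tame-facet = λ {s} s₁ s₂ e′ → facet s₁ (cover⇒- s₂ e′)
    ; tame-point = λ {x} s₁ s₂ e′ → point s₂ (cover⇒∪⁅⁆ s₁ e′)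
    }
    where
    D = ∣ σ ∣ + suc d
    ∣τ∣ : ∣ τ ∣ ≡ suc D
    ∣τ∣ = trans e (+-suc ∣ σ ∣ (suc d))
    lower : ∀ {t} → σ ⊂ t → t ⊂ τ → ∀ k → ∣ t ∣ ≡ ∣ σ ∣ + suc k → Boolean k σ t
    lower s s′ k e′ = boolean N k (ℕ.<-≤-trans (s≤s⁻¹ (rank-< ∣ σ ∣ s′ e′ e)) d<N) s e′
    upper : ∀ {s} → σ ⊂ s → s ⊂ τ → ∀ m → ∣ s ∣ + m ≡ D → Boolean m s τ
    upper {s} r r′ m e′ = boolean N m (ℕ.<-≤-trans (corank-< r refl e′) d<N) r′
      (trans ∣τ∣ (trans (cong suc (sym e′)) (sym (+-suc ∣ s ∣ m))))
    cone : ∀ {v} → v ∈ˢ τ → v ∉ˢ σ →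
      Tame (suc d) (Interval σ τ ∩ (_≢ τ - v)) (Interval σ τ) × Tame (suc d) ｛ σ ∪ˢ ⁅ v ⁆ ｝ (Interval σ τ)
    cone {v} v∈ v∉ =
      let t , t′ = expansion⇒tame ⊆-⊂-trans
            (λ s → s≤s⁻¹ (ℕ.≤-trans (p⊂q⇒∣p∣<∣q∣ s) (ℕ.≤-reflexive ∣τ∣))) refl
            (λ s₁ s₂ f c k e′ → Boolean.tame-facet (lower (⊂-trans s₁ s₂) f k e′) s₁ s₂ c)
            (λ s₁ f k e′ → Boolean.good (lower s₁ f k e′))
            (λ s₁ s₂ f c m e′ → Boolean.tame-point (upper s₁ (⊂-trans s₂ f) m e′) s₂ f c)
            (λ s₁ f m e′ → good-∅ m (Boolean.good (upper s₁ f m e′)))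
            (pairs faces) expansion (λ ρ → ρ ⊂? τ) rest
      in tame-resp (suc d) present≐ ≐-refl t , t′
      where
      x⊂τ : σ ∪ˢ ⁅ v ⁆ ⊂ τ
      x⊂τ with ⊆⇒≡⊎⊂ (∪⁅⁆-lub (p⊂q⇒p⊆q σ⊂τ) v∈)
      ... | inj₂ s = s
      ... | inj₁ refl with () ← ℕ.+-cancelˡ-≡ ∣ σ ∣ 1 (suc (suc d)) (trans (+-comm ∣ σ ∣ 1) (trans (sym (∣∪⁅⁆∣ σ v v∉)) e))
      open Cone v∈ v∉ σ⊂τ x⊂τ
      rest : ∀ {ρ} → Upper (_⊂ τ) σ ρ → ¬ Present x (pairs faces) ρ → ∣ ρ ∣ ≡ D
      rest {ρ} s ¬p with ρ ≟ˢ (τ - v)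
      ... | yes refl = suc-injective (trans (sym (∣-∣ v∈)) ∣τ∣)
      ... | no ne    = ⊥-elim (¬p (proj₂ present≐ (s , ne)))
    facet : ∀ {s} → σ ⊂ s → ∃[ v ] v ∉ˢ s × v ∈ˢ τ × s ≡ τ - v → Tame (suc d) (Interval σ τ ∩ (_≢ s)) (Interval σ τ)
    facet s₁ (v , v∉ , v∈ , refl) = proj₁ (cone v∈ (v∉ ∘ p⊂q⇒p⊆q s₁))
    point : ∀ {x} → x ⊂ τ → ∃[ v ] v ∉ˢ σ × x ≡ σ ∪ˢ ⁅ v ⁆ → Tame (suc d) ｛ x ｝ (Interval σ τ)
    point s₂ (v , v∉ , refl) = proj₂ (cone (p⊂q⇒p⊆q s₂ (∈-∪⁅⁆ σ)) v∉)

-- Rerooting expansions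

module _ {n : ℕ} where

  private
    variable
      F E E′ : Set′ {n}
      σ : Subset n

  expands-resp : ∀ {s t} → E ≐ E′ → Expands F σ E s t → Expands F σ E′ s t
  expands-resp (f , g) e = record
    { s∉E = s∉E ∘ g ; t∉E = t∉E ∘ g ; σ⊂s = σ⊂s ; s⊂t = s⊂t ; t∈F = t∈F ; cover = cover
    ; below = λ r r′ → Sum.map₂ f (below r r′) }
    where open Expands e

  -- The new start adds `y` and `t` to every later stage. Enlarging a stage preserves `below` and
  -- can only spoil the two fields of absence, which the last two hypotheses protect.
  expansion-prepend : ∀ {u y t} ps → Expansion F σ u ps →
    Expansion F σ y [] → Expands F σ ｛ y ｝ u t → ¬ Present u ps y → ¬ Present u ps t →
    ∃[ ps′ ] Expansion F σ y ps′ × Present y ps′ ≐ ((Present u ps ∪ ｛ t ｝) ∪ ｛ y ｝)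
  expansion-prepend {u = u} {y} {t} [] ex ey e _ _ = (u , t) ∷ [] , (ey , e) ,
    (λ { (inj₁ (inj₁ refl)) → inj₂ refl ; (inj₁ (inj₂ e)) → inj₁ (inj₂ e) ; (inj₂ refl) → inj₁ (inj₁ refl) }) ,
    (λ { (inj₁ (inj₁ refl)) → inj₂ refl ; (inj₁ (inj₂ e)) → inj₁ (inj₂ e) ; (inj₂ refl) → inj₁ (inj₁ refl) })
  expansion-prepend {u = u} {y} {t} ((s₁ , t₁) ∷ ps) (ex , e₁) ey e ny nt =
    let ps′ , ex′ , (f , g) = expansion-prepend ps ex ey e (ny ∘ inj₁ ∘ inj₁) (nt ∘ inj₁ ∘ inj₁) in
    (s₁ , t₁) ∷ ps′ ,
    (ex′ , record
      { s∉E = λ p → new s∉E (λ { refl → nt (inj₂ refl) }) (λ { refl → ny (inj₂ refl) }) (f p)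
      ; t∉E = λ p → new t∉E (λ { refl → nt (inj₁ (inj₂ refl)) }) (λ { refl → ny (inj₁ (inj₂ refl)) }) (f p)
      ; σ⊂s = σ⊂s ; s⊂t = s⊂t ; t∈F = t∈F ; cover = cover
      ; below = λ r r′ → Sum.map₂ (g ∘ inj₁ ∘ inj₁) (below r r′) }) ,
    ≐-trans (∪-cong (∪-cong (f , g) ≐-refl) ≐-refl)
      ((λ { (inj₁ (inj₁ (inj₁ (inj₁ a)))) → inj₁ (inj₁ (inj₁ (inj₁ a))) ; (inj₁ (inj₁ (inj₁ (inj₂ b)))) → inj₁ (inj₂ b)
          ; (inj₁ (inj₁ (inj₂ c))) → inj₂ c ; (inj₁ (inj₂ d)) → inj₁ (inj₁ (inj₁ (inj₂ d))) ; (inj₂ d) → inj₁ (inj₁ (inj₂ d)) }) ,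
       (λ { (inj₁ (inj₁ (inj₁ (inj₁ a)))) → inj₁ (inj₁ (inj₁ (inj₁ a))) ; (inj₁ (inj₂ b)) → inj₁ (inj₁ (inj₁ (inj₂ b)))
          ; (inj₂ c) → inj₁ (inj₁ (inj₂ c)) ; (inj₁ (inj₁ (inj₁ (inj₂ d)))) → inj₁ (inj₂ d) ; (inj₁ (inj₁ (inj₂ d))) → inj₂ d }))
    where
    open Expands e₁
    new : ∀ {z} → ¬ Present u ps z → t ≢ z → y ≢ z → ¬ ((Present u ps ∪ ｛ t ｝) ∪ ｛ y ｝) z
    new n₁ n₂ n₃ (inj₁ (inj₁ p)) = n₁ p
    new n₁ n₂ n₃ (inj₁ (inj₂ p)) = n₂ p
    new n₁ n₂ n₃ (inj₂ p)        = n₃ p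

  -- If the new root y is added as the lower member of a pair (y , t), then
  -- t = u ∪ y for a vertex u of the link: reroot at u and start with y, (u , t).
  reroot : (∀ {ρ τ} → ρ ⊆ˢ τ → F τ → F ρ) → ∀ {x} ps → Expansion F σ x ps →
    ∀ {y} → Present x ps y → ∣ y ∣ ≡ suc ∣ σ ∣ →
    ∃[ ps′ ] Expansion F σ y ps′ × Present y ps′ ≐ Present x ps
  reroot cl [] ex refl _ = [] , ex , ≐-refl
  reroot cl ((s , t) ∷ ps) (ex , e) (inj₁ (inj₁ p)) ∣y∣ =
    let ps′ , ex′ , eq = reroot cl ps ex p ∣y∣ in
    (s , t) ∷ ps′ , (ex′ , expands-resp (≐-sym eq) e) , ∪-cong (∪-cong eq ≐-refl) ≐-refl
  reroot cl ((s , t) ∷ ps) (ex , e) (inj₁ (inj₂ refl)) ∣y∣ = ⊥-elim (no-between σ⊂s s⊂t ∣y∣)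
    where open Expands e
  reroot {F = F} {σ} cl {x} ((s , t) ∷ ps) (ex , e) (inj₂ refl) ∣s∣ =
    via (cover⇒∪⁅⁆ s⊂t cover)
    where
    open Expands e
    via : ∃[ w ] w ∉ˢ s × t ≡ s ∪ˢ ⁅ w ⁆ → ∃[ ps′ ] Expansion F σ s ps′ × Present s ps′ ≐ Present x ((s , t) ∷ ps)
    via (w , w∉s , t≡) =
      let ps₁ , ex₁ , (f , g) = reroot cl ps ex u∈ ∣u∣
          ps₂ , ex₂ , eq = expansion-prepend ps₁ ex₁ (σ⊂s , ∣s∣ , cl (p⊂q⇒p⊆q s⊂t) t∈F) first (s∉E ∘ f) (t∉E ∘ f)
      in ps₂ , ex₂ , ≐-trans eq (∪-cong (∪-cong (f , g) ≐-refl) ≐-refl)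
      where
      u : Subset n
      u = σ ∪ˢ ⁅ w ⁆
      w∉σ : w ∉ˢ σ
      w∉σ = w∉s ∘ p⊂q⇒p⊆q σ⊂s
      w∈t : w ∈ˢ t
      w∈t = subst (w ∈ˢ_) (sym t≡) (∈-∪⁅⁆ s)
      ∣u∣ : ∣ u ∣ ≡ suc ∣ σ ∣
      ∣u∣ = ∣∪⁅⁆∣ σ w w∉σ
      ∣t∣ : ∣ t ∣ ≡ suc ∣ u ∣
      ∣t∣ = trans cover (cong suc (trans ∣s∣ (sym ∣u∣)))
      u⊂t : u ⊂ t
      u⊂t with ⊆⇒≡⊎⊂ (∪⁅⁆-lub (p⊂q⇒p⊆q σ⊂t) w∈t)
      ... | inj₂ r = r
      ... | inj₁ r = ⊥-elim (ℕ.1+n≢n (trans (sym ∣t∣) (cong ∣_∣ (sym r))))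
      u≢s : u ≢ s
      u≢s r = w∉s (subst (w ∈ˢ_) r (∈-∪⁅⁆ σ))
      u∈ : Present x ps u
      u∈ with below (⊂-∪⁅⁆ w∉σ) u⊂t
      ... | inj₁ r = ⊥-elim (u≢s r)
      ... | inj₂ p = p
      first : Expands F σ ｛ s ｝ u t
      first = record
        { s∉E = u≢s ∘ sym ; t∉E = λ r → ⊂-irref r s⊂t ; σ⊂s = ⊂-∪⁅⁆ w∉σ ; s⊂t = u⊂t ; t∈F = t∈F ; cover = ∣t∣
        ; below = between }
        where
        -- Here `t` is `σ` with two further elements, so only `u` and `s` lie strictly between.
        between : ∀ {ρ} → σ ⊂ ρ → ρ ⊂ t → ρ ≡ u ⊎ s ≡ ρ
        between {ρ} r r′ with w ∈ˢ? ρ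
        ... | yes w∈ = inj₁ (sym (⊆∧∣∣≤⇒≡ (∪⁅⁆-lub (p⊂q⇒p⊆q r) w∈)
              (s≤s⁻¹ (ℕ.≤-trans (p⊂q⇒∣p∣<∣q∣ r′) (ℕ.≤-reflexive ∣t∣)))))
        ... | no w∉ = inj₂ (sym (⊆∧∣∣≤⇒≡ ρ⊆s (ℕ.≤-trans (ℕ.≤-reflexive ∣s∣) (p⊂q⇒∣p∣<∣q∣ r))))
          where
          ρ⊆s : ρ ⊆ˢ s
          ρ⊆s {z} m with ∪⁅⁆⁻ {p = s} (subst (z ∈ˢ_) t≡ (p⊂q⇒p⊆q r′ m))
          ... | inj₁ m′   = m′
          ... | inj₂ refl = ⊥-elim (w∉ m)

  -- Collapses of a link as expansions

  module _ (K : Complex n) {σ : Subset n} where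

    private
      variable
        ρ τ : Subset n

    ∪─ : σ ⊆ˢ ρ → σ ∪ˢ (ρ ─ σ) ≡ ρ
    ∪─ {ρ} f = ⊆-antisym g h
      where
      g : σ ∪ˢ (ρ ─ σ) ⊆ˢ ρ
      g m with x∈p∪q⁻ σ (ρ ─ σ) m
      ... | inj₁ m′ = f m′
      ... | inj₂ m′ = p─q⊆p ρ σ m′
      h : ρ ⊆ˢ σ ∪ˢ (ρ ─ σ)
      h {v} m with v ∈ˢ? σ
      ... | yes m′ = x∈p∪q⁺ (inj₁ m′)
      ... | no ¬m  = x∈p∪q⁺ (inj₂ (x∈p∧x∉q⇒x∈p─q m ¬m))

    Disjoint : Subset n → Set
    Disjoint ρ = ∀ {v} → v ∈ˢ ρ → v ∉ˢ σ

    ∪-─ : Disjoint ρ → (σ ∪ˢ ρ) ─ σ ≡ ρ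
    ∪-─ {ρ} d = ⊆-antisym g (λ m → x∈p∧x∉q⇒x∈p─q (x∈p∪q⁺ (inj₂ m)) (d m))
      where
      g : (σ ∪ˢ ρ) ─ σ ⊆ˢ ρ
      g m with x∈p∪q⁻ σ ρ (p─q⊆p (σ ∪ˢ ρ) σ m)
      ... | inj₁ m′ = ⊥-elim (∉-─ {p = σ ∪ˢ ρ} m m′)
      ... | inj₂ m′ = m′

    lk⁻ : Face (lk σ K) ρ → Disjoint ρ × Face K (σ ∪ˢ ρ)
    lk⁻ (σ′ , f , s , refl) = (λ m → ∉-─ {p = σ′} m) , subst (Face K) (sym (∪─ s)) f

    lk⁺ : σ ⊆ˢ ρ → Face K ρ → Face (lk σ K) (ρ ─ σ)
    lk⁺ s f = _ , f , s , refl

    ─-mono : ρ ⊆ˢ τ → ρ ─ σ ⊆ˢ τ ─ σ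
    ─-mono {ρ} f m = x∈p∧x∉q⇒x∈p─q (f (p─q⊆p ρ σ m)) (∉-─ {p = ρ} m)

    ─-⊆ : ρ ⊆ˢ σ ∪ˢ τ → ρ ─ σ ⊆ˢ τ
    ─-⊆ {ρ} {τ} f m with x∈p∪q⁻ σ τ (f (p─q⊆p ρ σ m))
    ... | inj₁ m′ = ⊥-elim (∉-─ {p = ρ} m m′)
    ... | inj₂ m′ = m′

    Above : Complex n → Set′
    Above L ρ = σ ⊂ ρ × Face L (ρ ─ σ)

    -- The first collapse is undone last, so it becomes the head of the list. The unions with `σ`
    -- translate faces of the link into faces of `K`.
    collapse⇒expansion : ∀ {L M} → Star _↘_ L M → IsPoint M → Face L ⊆ Face (lk σ K) →
      ∃[ x ] ∃[ ps ] Expansion (Face K) σ x ps × Present x ps ≐ Above L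
    collapse⇒expansion {L} ε (v , p , q) sub =
      σ ∪ˢ ⁅ v ⁆ , [] , (⊂-∪⁅⁆ v∉ , ∣∪⁅⁆∣ σ v v∉ , proj₂ (lk⁻ v∈)) ,
      (λ { refl → ⊂-∪⁅⁆ v∉ , subst (Face L) (sym (∪-─ (proj₁ (lk⁻ v∈)))) (q (there (here refl))) }) ,
      λ {ρ} (s , f) → point s (p f)
      where
      v∈ = sub (q (there (here refl)))
      v∉ : v ∉ˢ σ
      v∉ = proj₁ (lk⁻ v∈) (x∈⁅x⁆ v)
      point : ∀ {ρ} → σ ⊂ ρ → ρ ─ σ ∈ ⊥ˢ ∷ ⁅ v ⁆ ∷ [] → σ ∪ˢ ⁅ v ⁆ ≡ ρ
      point {ρ} (_ , w , w∈ , w∉) (here e) = ⊥-elim (∉⊥ (subst (w ∈ˢ_) e (x∈p∧x∉q⇒x∈p─q w∈ w∉)))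
      point (f , _) (there (here e)) = trans (cong (σ ∪ˢ_) (sym e)) (∪─ f)
    collapse⇒expansion {L} (_◅_ {j = L′} c cs) pt sub =
      let x , ps , ex , (f , g) = collapse⇒expansion cs pt (sub ∘ proj₁ ∘ proj₁ result) in
      x , (σ ∪ˢ s , σ ∪ˢ t) ∷ ps , (ex , expands-resp (g , f) expands) ,
      ≐-trans (∪-cong (∪-cong (f , g) ≐-refl) ≐-refl) (from , λ (r , m) → to r m)
      where
      open _↘_ c renaming (σ to s; τ to t; σ∈K to s∈L; τ∈K to t∈L; σ⊂τ to s⊂t)
      s-disj : Disjoint s
      s-disj = proj₁ (lk⁻ (sub s∈L))
      t-disj : Disjoint t
      t-disj = proj₁ (lk⁻ (sub t∈L))
      σ⊂s : σ ⊂ σ ∪ˢ s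
      σ⊂s = let v , m = nonempty in p⊆p∪q s , v , q⊆p∪q σ s m , s-disj m
      w : Fin n
      w = proj₁ (proj₂ s⊂t)
      w∈t = proj₁ (proj₂ (proj₂ s⊂t))
      w∉s = proj₂ (proj₂ (proj₂ s⊂t))
      -- A free face has codimension one: adding any `w` of `t` to `s` already gives a face properly
      -- containing `s`, which must be `t`.
      t≡ : s ∪ˢ ⁅ w ⁆ ≡ t
      t≡ = unique (s ∪ˢ ⁅ w ⁆) (⊆-closed L (∪⁅⁆-lub (proj₁ s⊂t) w∈t) t∈L) (⊂-∪⁅⁆ w∉s)
      σt≡ : σ ∪ˢ t ≡ (σ ∪ˢ s) ∪ˢ ⁅ w ⁆
      σt≡ = trans (cong (σ ∪ˢ_) (sym t≡)) (sym (∪-assocˢ σ s ⁅ w ⁆))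
      w∉ : w ∉ˢ σ ∪ˢ s
      w∉ m with x∈p∪q⁻ σ s m
      ... | inj₁ m′ = t-disj w∈t m′
      ... | inj₂ m′ = w∉s m′
      st : σ ∪ˢ s ⊂ σ ∪ˢ t
      st = subst (σ ∪ˢ s ⊂_) (sym σt≡) (⊂-∪⁅⁆ w∉)
      to : ∀ {ρ} → σ ⊂ ρ → Face L (ρ ─ σ) → ((Above L′ ∪ ｛ σ ∪ˢ t ｝) ∪ ｛ σ ∪ˢ s ｝) ρ
      to {ρ} r m with (ρ ─ σ) ≟ˢ s | (ρ ─ σ) ≟ˢ t
      ... | yes e | _ = inj₂ (trans (cong (σ ∪ˢ_) (sym e)) (∪─ (proj₁ r)))
      ... | no _  | yes e = inj₁ (inj₂ (trans (cong (σ ∪ˢ_) (sym e)) (∪─ (proj₁ r))))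
      ... | no e  | no e′ = inj₁ (inj₁ (r , proj₂ result (m , λ { (here i) → e i ; (there (here i)) → e′ i })))
      from : ((Above L′ ∪ ｛ σ ∪ˢ t ｝) ∪ ｛ σ ∪ˢ s ｝) ⊆ Above L
      from (inj₁ (inj₁ (r , m))) = r , proj₁ (proj₁ result m)
      from (inj₁ (inj₂ refl))    = ⊂-trans σ⊂s st , subst (Face L) (sym (∪-─ t-disj)) t∈L
      from (inj₂ refl)           = σ⊂s , subst (Face L) (sym (∪-─ s-disj)) s∈L
      expands : Expands (Face K) σ (Above L′) (σ ∪ˢ s) (σ ∪ˢ t)
      expands = record
        { s∉E = λ (_ , m) → proj₂ (proj₁ result m) (here (∪-─ s-disj))
        ; t∉E = λ (_ , m) → proj₂ (proj₁ result m) (there (here (∪-─ t-disj)))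
        ; σ⊂s = σ⊂s ; s⊂t = st ; t∈F = proj₂ (lk⁻ (sub t∈L))
        ; cover = trans (cong ∣_∣ σt≡) (∣∪⁅⁆∣ (σ ∪ˢ s) w w∉)
        ; below = λ r r′ → below r r′ (to r (⊆-closed L (─-⊆ (proj₁ r′)) t∈L)) }
        where
        below : ∀ {ρ} → σ ⊂ ρ → ρ ⊂ σ ∪ˢ t → ((Above L′ ∪ ｛ σ ∪ˢ t ｝) ∪ ｛ σ ∪ˢ s ｝) ρ → ρ ≡ σ ∪ˢ s ⊎ Above L′ ρ
        below r r′ (inj₁ (inj₁ a))    = inj₂ a
        below r r′ (inj₁ (inj₂ refl)) = ⊥-elim (⊂-irref refl r′)
        below r r′ (inj₂ e)           = inj₁ (sym e)

  -- Good orders of the links under HRC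

  module Links (K : Complex n) {D : ℕ} (bound : ∀ {τ} → Face K τ → ∣ τ ∣ ≤ D)
    (enlarge : ∀ {τ} → Face K τ → ∣ τ ∣ < D → ∃[ ρ ] τ ⊂ ρ × Face K ρ) (hrc : HRC K) where

    -- If `x` survives the removal of facets, the expansion is rerooted at it. Otherwise `x` is
    -- itself a removed facet, so `D` is one more than the size of `σ`; then all faces above `σ`
    -- have full size and `x` alone is a valid start.
    rooted : ∀ {σ x} → Face K σ → σ ⊂ x → ∣ x ∣ ≡ suc ∣ σ ∣ → Face K x →
      ∃[ ps ] Expansion (Face K) σ x ps × (∀ {ρ} → Upper (Face K) σ ρ → ¬ Present x ps ρ → ∣ ρ ∣ ≡ D)
    rooted {σ} {x} σ∈ s ∣x∣ x∈ with hrc σ σ∈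
    ... | inj₁ none = ⊥-elim (let v , v∉ , e = cover⇒∪⁅⁆ s ∣x∣ in
            none v (x , x∈ , p⊂q⇒p⊆q s , sym (trans (cong (_─ σ) e) (∪-─ K λ m → subst (_∉ˢ σ) (sym (x∈⁅y⁆⇒x≡y v m)) v∉))))
    ... | inj₂ (φs , facets , L , (f , g) , M , star , point) =
      choose (collapse⇒expansion K star point (proj₁ ∘ f))
      where
      -- A face missing from `L` is a removed facet of the link; were it smaller than `D`, `enlarge`
      -- would contradict its maximality.
      top : ∀ {ρ} → Upper (Face K) σ ρ → ¬ Above K L ρ → ∣ ρ ∣ ≡ D
      top {ρ} (r , ρ∈) ¬a with ∣ ρ ∣ ℕ.≟ D
      ... | yes e = e
      ... | no ne = ⊥-elim (¬a (r , g (lk⁺ K (proj₁ r) ρ∈ , λ m →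
        let τ , ρ⊂τ , τ∈ = enlarge ρ∈ (ℕ.≤∧≢⇒< (bound ρ∈) ne)
            σ⊆τ = ⊆-trans (proj₁ r) (proj₁ ρ⊂τ)
            eq = proj₂ (All.lookup facets m) (τ ─ σ) (lk⁺ K σ⊆τ τ∈) (─-mono K (proj₁ ρ⊂τ))
        in ⊂-irref (trans (sym (∪─ K (proj₁ r))) (trans (cong (σ ∪ˢ_) eq) (∪─ K σ⊆τ))) ρ⊂τ)))
      choose : ∃[ y ] ∃[ ps ] Expansion (Face K) σ y ps × Present y ps ≐ Above K L →
        ∃[ ps ] Expansion (Face K) σ x ps × (∀ {ρ} → Upper (Face K) σ ρ → ¬ Present x ps ρ → ∣ ρ ∣ ≡ D)
      choose (y , ps , ex , eq) with present? y ps x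
      ... | yes p = let ps′ , ex′ , eq′ = reroot (⊆-closed K) ps ex p ∣x∣ in
            ps′ , ex′ , λ u ¬p → top u (¬p ∘ proj₂ (≐-trans eq′ eq))
      ... | no ¬p = [] , (s , ∣x∣ , x∈) , λ (r , ρ∈) _ →
            ℕ.≤-antisym (bound ρ∈)
              (ℕ.≤-trans (ℕ.≤-reflexive (trans (sym (top (s , x∈) (¬p ∘ proj₂ eq))) ∣x∣)) (p⊂q⇒∣p∣<∣q∣ r))

    -- Induction on the corank `m`, bounded by `N`: the faces above `s` and `t` are covered by the
    -- induction, the intervals below them by `boolean`.
    links : ∀ N m → m < N → ∀ {σ} → Face K σ → ∣ σ ∣ + m ≡ D →
      Good m ∅ (Upper (Face K) σ) ×
      (∀ {x} → σ ⊂ x → ∣ x ∣ ≡ suc ∣ σ ∣ → Face K x → Tame m ｛ x ｝ (Upper (Face K) σ))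
    links (suc N) zero _ {σ} σ∈ e =
      ((λ _ (s , f) → none s f) , λ _ ()) , λ s _ f → ⊥-elim (none s f)
      where
      none : ∀ {ρ} → σ ⊂ ρ → Face K ρ → ⊥
      none s f = ℕ.<-irrefl (trans (sym (+-identityʳ ∣ σ ∣)) e) (ℕ.<-≤-trans (p⊂q⇒∣p∣<∣q∣ s) (bound f))
    links (suc N) (suc d) (s≤s d<N) {σ} σ∈ e = good , tame
      where
      upper : ∀ {τ} → σ ⊂ τ → Face K τ → ∀ m → ∣ τ ∣ + m ≡ D → _
      upper {τ} s f m e′ = links N m (ℕ.<-≤-trans (corank-< s e e′) d<N) f e′
      tame : ∀ {x} → σ ⊂ x → ∣ x ∣ ≡ suc ∣ σ ∣ → Face K x → Tame (suc d) ｛ x ｝ (Upper (Face K) σ)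
      tame s c x∈ = let ps , ex , rest = rooted σ∈ s c x∈ in
        proj₂ (expansion⇒tame (⊆-closed K) bound e
          (λ s₁ s₂ f c k e′ → Boolean.tame-facet (boolean (suc k) k ℕ.≤-refl (⊂-trans s₁ s₂) e′) s₁ s₂ c)
          (λ s₁ f k e′ → Boolean.good (boolean (suc k) k ℕ.≤-refl s₁ e′))
          (λ s₁ s₂ f c m e′ → proj₂ (upper s₁ (⊆-closed K (proj₁ s₂) f) m e′) s₂ c f)
          (λ s₁ f m e′ → proj₁ (upper s₁ f m e′))
          ps ex (face? K) rest)
      good : Good (suc d) ∅ (Upper (Face K) σ)
      good =
        let τ , s , τ∈ = enlarge σ∈
              (ℕ.≤-trans (ℕ.≤-trans (s≤s (ℕ.m≤m+n ∣ σ ∣ d)) (ℕ.≤-reflexive (sym (+-suc ∣ σ ∣ d)))) (ℕ.≤-reflexive e))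
            v , v∉ , _ , g = ⊂⇒∪⁅⁆⊆ s
        in good-∅ (suc d) (tame⇒good (suc d) (tame (⊂-∪⁅⁆ v∉) (∣∪⁅⁆∣ σ v v∉) (⊆-closed K g τ∈)))

-- Codes of chains, dimensions, and a criterion for shellings

private
  variable
    n : ℕ

codes-⊆ : ∀ {xs ys : List (Subset n)} → (∀ {x} → x ∈ xs → x ∈ ys) → codes xs ⊆ˢ codes ys
codes-⊆ {xs = xs} f m with ∈-codes⁻ xs m
... | x , x∈ , refl = ∈-codes⁺ (f x∈)

code∈codes⁻ : ∀ {xs : List (Subset n)} {x} → code x ∈ˢ codes xs → x ∈ xs
code∈codes⁻ {xs = xs} m with ∈-codes⁻ xs m
... | y , y∈ , e = subst (_∈ xs) (sym (code-injective e)) y∈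

codes-⊆⁻ : ∀ {xs ys : List (Subset n)} → codes xs ⊆ˢ codes ys → ∀ {x} → x ∈ xs → x ∈ ys
codes-⊆⁻ f m = code∈codes⁻ (f (∈-codes⁺ m))

∣codes∣ : ∀ {xs : List (Subset n)} → Unique xs → ∣ codes xs ∣ ≡ length xs
∣codes∣ {n} {[]} [] = ∣⊥∣≡0 (2 ^ n)
∣codes∣ {xs = x ∷ xs} (a ∷ as) =
  trans (cong ∣_∣ (∪-commˢ ⁅ code x ⁆ (codes xs)))
    (trans (∣∪⁅⁆∣ (codes xs) (code x) λ m → All.lookup a (code∈codes⁻ m) refl) (cong suc (∣codes∣ as)))

allPairs-map∈ : ∀ {A : Set} {R Q : A → A → Set} {xs} → (∀ {x y} → x ∈ xs → y ∈ xs → R x y → Q x y) →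
  AllPairs R xs → AllPairs Q xs
allPairs-map∈ f []       = []
allPairs-map∈ f (a ∷ as) =
  All.tabulate (λ m → f (here refl) (there m) (All.lookup a m)) ∷ allPairs-map∈ (λ m m′ → f (there m) (there m′)) as

allPairs-reverse : ∀ {A : Set} {R : A → A → Set} {xs} → AllPairs R xs → AllPairs (λ x y → R y x) (reverse xs)
allPairs-reverse [] = []
allPairs-reverse {xs = x ∷ xs} (a ∷ as) rewrite unfold-reverse x xs =
  AllPairs.++⁺ (allPairs-reverse as) ([] ∷ [])
    (All.tabulate λ m → All.lookup a (Any.reverse⁻ m) ∷ [])

⊂⇒≢ : ∀ {p q : Subset n} → p ⊂ q → p ≢ q
⊂⇒≢ s e = ⊂-irref e s

chain-unique : ∀ {σs : List (Subset n)} → Linked _⊂_ σs → Unique σs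
chain-unique l = AllPairs.map ⊂⇒≢ (Linked.Linked⇒AllPairs ⊂-trans l)

dim-cancel-≤ : ∀ {a b} → ℤ.+ a ℤ.- ℤ.1ℤ ℤ.≤ ℤ.+ b ℤ.- ℤ.1ℤ → a ≤ b
dim-cancel-≤ {zero}          _  = z≤n
dim-cancel-≤ {suc a} {suc b} le = s≤s (ℤ.drop‿+≤+ le)

dim-mono-≤ : ∀ {a b} → a ≤ b → ℤ.+ a ℤ.- ℤ.1ℤ ℤ.≤ ℤ.+ b ℤ.- ℤ.1ℤ
dim-mono-≤ le = ℤ.+-monoˡ-≤ (ℤ.- ℤ.1ℤ) (ℤ.+≤+ le)

dim-cancel : ∀ {a b} → ℤ.+ a ℤ.- ℤ.1ℤ ≡ ℤ.+ b ℤ.- ℤ.1ℤ → a ≡ b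
dim-cancel e = ℕ.≤-antisym (dim-cancel-≤ (ℤ.≤-reflexive e)) (dim-cancel-≤ (ℤ.≤-reflexive (sym e)))

before-take⁺ : ∀ {A : Set} (xs : List A) i {p} → p ∈ take (toℕ i) xs → Before xs p (lookup xs i)
before-take⁺ (x ∷ xs) (Fin.suc i) (here refl) = here (∈-lookup i)
  where
  ∈-lookup : ∀ {A : Set} {xs : List A} i → lookup xs i ∈ xs
  ∈-lookup {xs = _ ∷ _} Fin.zero    = here refl
  ∈-lookup {xs = _ ∷ _} (Fin.suc i) = there (∈-lookup i)
before-take⁺ (x ∷ xs) (Fin.suc i) (there m)   = there (before-take⁺ xs i m)

before-take⁻ : ∀ {A : Set} {xs : List A} → Unique xs → ∀ i {p} → Before xs p (lookup xs i) → p ∈ take (toℕ i) xs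
before-take⁻ (a ∷ as) Fin.zero    (here m)  = ⊥-elim (All.lookup a m refl)
before-take⁻ (a ∷ as) Fin.zero    (there b) = ⊥-elim (All.lookup a (before⇒∈ʳ b) refl)
before-take⁻ (a ∷ as) (Fin.suc i) (here m)  = here refl
before-take⁻ (a ∷ as) (Fin.suc i) (there b) = there (before-take⁻ as i b)

before⇒allPairs : ∀ {A : Set} {R : A → A → Set} xs → (∀ {p q} → Before xs p q → R p q) → AllPairs R xs
before⇒allPairs []       f = []
before⇒allPairs (x ∷ xs) f = All.tabulate (f ∘ here) ∷ before⇒allPairs xs (f ∘ there)

⋃ᶜ⁺ : ∀ {Ps : List (Subset n)} {P ρ} → P ∈ Ps → ρ ⊆ˢ P → Face (⋃ᶜ (map ⟪_⟫ Ps)) ρ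
⋃ᶜ⁺ (here refl) s = inj₁ s
⋃ᶜ⁺ (there m)   s = inj₂ (⋃ᶜ⁺ m s)

⋃ᶜ⁻ : ∀ (Ps : List (Subset n)) {ρ} → Face (⋃ᶜ (map ⟪_⟫ Ps)) ρ → ∃[ P ] P ∈ Ps × ρ ⊆ˢ P
⋃ᶜ⁻ (P ∷ Ps) (inj₁ s) = P , here refl , s
⋃ᶜ⁻ (P ∷ Ps) (inj₂ f) = let Q , m , s = ⋃ᶜ⁻ Ps f in Q , there m , s

-- Every face that `Q` shares with an earlier facet lies in some `R ∩ˢ Q` of size `D` minus one, so
-- these are the facets of the intersection. Repetitions are excluded too: for `P ≡ Q` the set
-- `R ∩ˢ Q` would contain `Q`.
isShelling : ∀ {K : Complex n} {D Fs} →
  (∀ F → F ∈ Fs → Facet K F) → (∀ F → Facet K F → F ∈ Fs) → (∀ {F} → F ∈ Fs → ∣ F ∣ ≡ D) →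
  (∀ {P Q} → Before Fs P Q → ∃[ R ] Before Fs R Q × P ∩ˢ Q ⊆ˢ R × suc ∣ R ∩ˢ Q ∣ ≡ D) →
  IsShelling K (ℤ.+ D ℤ.- ℤ.1ℤ) Fs
isShelling {n} {K} {D} {Fs} facet⁺ facet⁻ size sep = record
  { distinct = unique
  ; facets   = λ F → mk⇔ (facet⁺ F) (facet⁻ F)
  ; shelling = shelling
  }
  where
  unique : Unique Fs
  unique = before⇒allPairs Fs λ {P} {Q} b e →
    let R , _ , s , r = sep b in
    ℕ.1+n≰n (ℕ.≤-trans (ℕ.≤-reflexive r) (ℕ.≤-trans (ℕ.≤-reflexive (sym (size (before⇒∈ʳ b))))
      (p⊆q⇒∣p∣≤∣q∣ λ {x} m → x∈p∩q⁺ (s (x∈p∩q⁺ (subst (x ∈ˢ_) (sym e) m , m)) , m))))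
  shelling : ∀ (i : Fin (length Fs)) → 0 < toℕ i →
    let L = ⟪ lookup Fs i ⟫ ∩ᶜ ⋃ᶜ (map ⟪_⟫ (take (toℕ i) Fs))
    in Pure L × HasDimension L (ℤ.+ D ℤ.- ℤ.1ℤ ℤ.- ℤ.1ℤ)
  shelling i 0<i = (λ σ τ f g → trans (facet-dim σ f) (sym (facet-dim τ g))) ,
    (let P , m = earlier Fs i 0<i ; R , R∈ , _ , ∣R∣ = cut (λ m → proj₂ (x∈p∩q⁻ P Q m)) m (p∩q⊆p P Q) in
     R ∩ˢ Q , R∩Q∈L R∈ , dim≡ R ∣R∣) ,
    (λ σ (s , u) → let P , m , s′ = ⋃ᶜ⁻ _ u ; R , R∈ , s″ , ∣R∣ = cut s m s′ in
     ℤ.≤-trans (dim-mono-≤ (p⊆q⇒∣p∣≤∣q∣ s″)) (ℤ.≤-reflexive (dim≡ R ∣R∣)))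
    where
    Q = lookup Fs i
    L = ⟪ Q ⟫ ∩ᶜ ⋃ᶜ (map ⟪_⟫ (take (toℕ i) Fs))
    earlier : ∀ {A : Set} (xs : List A) (i : Fin (length xs)) → 0 < toℕ i → ∃[ P ] P ∈ take (toℕ i) xs
    earlier (x ∷ xs) (Fin.suc i) _ = x , here refl
    cut : ∀ {σ P} → σ ⊆ˢ Q → P ∈ take (toℕ i) Fs → σ ⊆ˢ P →
      ∃[ R ] R ∈ take (toℕ i) Fs × σ ⊆ˢ R ∩ˢ Q × suc ∣ R ∩ˢ Q ∣ ≡ D
    cut s m s′ = let R , b , t , e = sep (before-take⁺ Fs i m) in
      R , before-take⁻ unique i b , (λ x∈ → x∈p∩q⁺ (t (x∈p∩q⁺ (s′ x∈ , s x∈)) , s x∈)) , e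
    R∩Q∈L : ∀ {R} → R ∈ take (toℕ i) Fs → Face L (R ∩ˢ Q)
    R∩Q∈L {R} m = p∩q⊆q R Q , ⋃ᶜ⁺ m (p∩q⊆p R Q)
    dim≡ : ∀ R → suc ∣ R ∩ˢ Q ∣ ≡ D → dim (R ∩ˢ Q) ≡ ℤ.+ D ℤ.- ℤ.1ℤ ℤ.- ℤ.1ℤ
    dim≡ R e = subst (λ D → dim (R ∩ˢ Q) ≡ ℤ.+ D ℤ.- ℤ.1ℤ ℤ.- ℤ.1ℤ) e refl
    facet-dim : ∀ σ → Facet L σ → dim σ ≡ ℤ.+ D ℤ.- ℤ.1ℤ ℤ.- ℤ.1ℤ
    facet-dim σ ((s , u) , mx) =
      let P , m , s′ = ⋃ᶜ⁻ _ u ; R , R∈ , s″ , ∣R∣ = cut s m s′ in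
      trans (cong dim (mx (R ∩ˢ Q) (R∩Q∈L R∈) s″)) (dim≡ R ∣R∣)

-- Facets of the second subdivision as flags of words

module Flags {n : ℕ} (K : Complex n) where

  open Words (_~_ {n}) ~-sym (λ {p} → ~-irrefl {p = p}) _≟ˢ_
  open DecMembership (_≟ˢ_ {n}) using (_∈?_)

  S : Set′
  S = Upper (Face K) ⊥ˢ

  clique⇒allPairs : ∀ {S} w → Clique S w → AllPairs _~_ w
  clique⇒allPairs []      _       = []
  clique⇒allPairs (b ∷ w) (_ , c) =
    All.tabulate (λ m → ~-sym (proj₂ (clique⇒⊆ w c m))) ∷ clique⇒allPairs w c

  allPairs⇒clique : ∀ {S : Set′} w → (∀ {x} → x ∈ w → S x) → AllPairs _~_ w → Clique S w
  allPairs⇒clique []      _ _        = tt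
  allPairs⇒clique (b ∷ w) f (a ∷ as) =
    f (here refl) , allPairs⇒clique w (λ m → f (there m) , ~-sym (All.lookup a m)) as

  ~⇒≢ : ∀ {p q : Subset n} → p ~ q → p ≢ q
  ~⇒≢ a refl = ~-irrefl a

  clique-unique : ∀ {S w} → Clique S w → Unique w
  clique-unique {w = w} c = AllPairs.map ~⇒≢ (clique⇒allPairs w c)

  allPairs-lookup : ∀ {A : Set} {R : A → A → Set} {xs} → AllPairs R xs → ∀ {x y} → x ∈ xs → y ∈ xs → x ≡ y ⊎ R x y ⊎ R y x
  allPairs-lookup (a ∷ as) (here refl) (here refl) = inj₁ refl
  allPairs-lookup (a ∷ as) (here refl) (there m)   = inj₂ (inj₁ (All.lookup a m))
  allPairs-lookup (a ∷ as) (there m)   (here refl) = inj₂ (inj₂ (All.lookup a m))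
  allPairs-lookup (a ∷ as) (there m)   (there m′)  = allPairs-lookup as m m′

  clique-adjacent : ∀ {S w x y} → Clique S w → x ∈ w → y ∈ w → x ≢ y → x ~ y
  clique-adjacent {w = w} c m m′ ne with allPairs-lookup (clique⇒allPairs w c) m m′
  ... | inj₁ e        = ⊥-elim (ne e)
  ... | inj₂ (inj₁ a) = a
  ... | inj₂ (inj₂ a) = ~-sym a

  -- A face of `sd K` needs its members sorted by inclusion. Filtering the decreasing list of all
  -- subsets and reversing it does the sorting.
  clique⇒face : ∀ {w} → Clique S w → Face (sd K) (codes w)
  clique⇒face {w} c = chain ,
    (All.tabulate (λ m → let s , f = clique⇒⊆ w c (chain⁻ m) in f , (let v , v∈ , _ = proj₂ s in v , v∈)) ,
     Linked.AllPairs⇒Linked (allPairs-reverse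
       (allPairs-map∈ comparable (AllPairs.filter⁺ (_∈? w) (subsets-decreasing n))))) ,
    ⊆-antisym (codes-⊆ {xs = w} chain⁺) (codes-⊆ {xs = chain} chain⁻)
    where
    sorted chain : List (Subset n)
    sorted = filter (_∈? w) (subsets n)
    chain = reverse sorted
    sorted⁻ : ∀ {x} → x ∈ sorted → x ∈ w
    sorted⁻ m = proj₂ (∈-filter⁻ (_∈? w) {xs = subsets n} m)
    chain⁻ : ∀ {x} → x ∈ chain → x ∈ w
    chain⁻ m = sorted⁻ (Any.reverse⁻ m)
    chain⁺ : ∀ {x} → x ∈ w → x ∈ chain
    chain⁺ m = Any.reverse⁺ (∈-filter⁺ (_∈? w) (∈-subsets _) m)
    comparable : ∀ {p q} → p ∈ sorted → q ∈ sorted → ¬ p ⊆ˢ q → q ⊂ p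
    comparable {p} {q} m m′ ns with clique-adjacent c (sorted⁻ m) (sorted⁻ m′) (λ { refl → ns ⊆-refl })
    ... | inj₁ s = ⊥-elim (ns (proj₁ s))
    ... | inj₂ s = s

  nonempty⇒⊥⊂ : ∀ {p : Subset n} → Nonempty p → ⊥ˢ ⊂ p
  nonempty⇒⊥⊂ (v , v∈) = ⊥⊆ , v , v∈ , ∉⊥

  face⇒clique : ∀ {T} → Face (sd K) T → ∃[ w ] Clique S w × T ≡ codes w
  face⇒clique (σs , (fs , l) , e) = σs , allPairs⇒clique {S = S} σs
    (λ m → let f , ne = All.lookup fs m in nonempty⇒⊥⊂ ne , f)
    (AllPairs.map inj₁ (Linked.Linked⇒AllPairs ⊂-trans l)) , e

  -- The index `suc k` skips the empty prefix, since vertices of a subdivision are nonempty faces.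
  levels : List (Subset n) → List (Subset (2 ^ n))
  levels w = applyUpTo (λ k → codes (take (suc k) w)) (length w)

  flag : List (Subset n) → Subset (2 ^ (2 ^ n))
  flag w = codes (levels w)

  clique-take : ∀ {S} k w → Clique S w → Clique S (take k w)
  clique-take zero    w       c       = tt
  clique-take (suc k) []      c       = tt
  clique-take (suc k) (b ∷ w) (s , c) = s , clique-take k w c

  ∣take∣ : ∀ {S w} k → Clique S w → k ≤ length w → ∣ codes (take k w) ∣ ≡ k
  ∣take∣ {w = w} k c le = trans (∣codes∣ (clique-unique (clique-take k w c)))
    (trans (length-take k w) (ℕ.m≤n⇒m⊓n≡m le))

  levels-chain : ∀ {w} → Clique S w → IsChain (sd K) (levels w)
  levels-chain {w} c =
    All.tabulate (λ m → let k , k< , e = ∈-applyUpTo⁻ _ m in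
      subst (λ T → Face (sd K) T × Nonempty T) (sym e) (clique⇒face (clique-take (suc k) w c) , nonempty k w k<)) ,
    Linked.applyUpTo⁺₁ _ (length w) λ {k} k< → grow k k<
    where
    nonempty : ∀ k w → k < length w → Nonempty (codes (take (suc k) w))
    nonempty k (x ∷ w) _ = code x , ∈-codes⁺ {σs = take (suc k) (x ∷ w)} (here refl)
    take-⊆ : ∀ {A : Set} k (w : List A) {x} → x ∈ take k w → x ∈ take (suc k) w
    take-⊆ (suc k) (y ∷ w) (here e)  = here e
    take-⊆ (suc k) (y ∷ w) (there m) = there (take-⊆ k w m)
    grow : ∀ k → suc k < length w → codes (take (suc k) w) ⊂ codes (take (suc (suc k)) w)
    grow k k< with ⊆⇒≡⊎⊂ (codes-⊆ {xs = take (suc k) w} {take (suc (suc k)) w} (take-⊆ (suc k) w))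
    ... | inj₂ s = s
    ... | inj₁ e = ⊥-elim (ℕ.1+n≢n (sym
          (trans (sym (∣take∣ (suc k) c (ℕ.<⇒≤ k<))) (trans (cong ∣_∣ e) (∣take∣ (suc (suc k)) c k<)))))

  flag-face : ∀ {w} → Clique S w → Face (sd (sd K)) (flag w)
  flag-face {w} c = levels w , levels-chain c , refl

  ∣flag∣ : ∀ {w} → Clique S w → ∣ flag w ∣ ≡ length w
  ∣flag∣ {w} c = trans (∣codes∣ (chain-unique (proj₂ (levels-chain c)))) (length-applyUpTo _ (length w))

  take-≈⇒∈-flag : ∀ {p q j} → j < length p → take (suc j) p ≈ take (suc j) q → code (codes (take (suc j) q)) ∈ˢ flag p
  take-≈⇒∈-flag {p} {q} {j} j< (f , g) = ∈-codes⁺ (subst (_∈ levels p)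
    (⊆-antisym (codes-⊆ {xs = take (suc j) p} f) (codes-⊆ {xs = take (suc j) q} g)) (∈-applyUpTo⁺ _ j<))

  -- The letters of a clique are distinct, so the size of a member of a flag is the length of its
  -- prefix; equal members therefore come from prefixes of equal length.
  ∈-flag⇒take-≈ : ∀ {p q j} → Clique S p → Clique S q → j < length q → code (codes (take (suc j) q)) ∈ˢ flag p →
    take (suc j) p ≈ take (suc j) q
  ∈-flag⇒take-≈ {p} {q} {j} cp cq j< m with ∈-applyUpTo⁻ _ (code∈codes⁻ {xs = levels p} m)
  ... | k , k< , e with trans (sym (∣take∣ (suc j) cq j<)) (trans (cong ∣_∣ e) (∣take∣ (suc k) cp k<))
  ...   | refl = codes-⊆⁻ {xs = take (suc j) p} (λ {x} m → subst (x ∈ˢ_) (sym e) m) ,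
                 codes-⊆⁻ {xs = take (suc j) q} (λ {x} m → subst (x ∈ˢ_) e m)

  ∈-flag⁻ : ∀ {w x} → x ∈ˢ flag w → ∃[ j ] j < length w × x ≡ code (codes (take (suc j) w))
  ∈-flag⁻ {w} m with ∈-codes⁻ (levels w) m
  ... | T , T∈ , refl = let j , j< , e = ∈-applyUpTo⁻ _ T∈ in j , j< , cong code e

  take-length-++ : ∀ {A : Set} (u z : List A) → take (length u) (u ++ z) ≡ u
  take-length-++ []      z = refl
  take-length-++ (x ∷ u) z = cong (x ∷_) (take-length-++ u z)

  -- The word spells the chain: for each `T` in turn it appends the members of `T` not yet used.
  chain⇒word : ∀ Ts u → All (λ T → Face (sd K) T × Nonempty T) Ts → AllPairs _⊂_ Ts → Clique S u →
    All (λ T → codes u ⊆ˢ T) Ts →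
    ∃[ z ] Clique S (u ++ z) × All (λ T → ∃[ k ] k ≤ length (u ++ z) × T ≡ codes (take k (u ++ z))) Ts
  chain⇒word [] u _ _ c _ = [] , subst (Clique S) (sym (++-identityʳ u)) c , []
  chain⇒word (T ∷ Ts) u ((T∈ , _) ∷ fs) (a ∷ as) c (s ∷ _) with face⇒clique T∈
  ... | v , cv , refl =
    let z , cz , ls = chain⇒word Ts (u ++ new) fs as c′ (All.map later a)
        eq = ++-assoc u new z
    in new ++ z , subst (Clique S) eq cz ,
       subst (λ w → All (λ T → ∃[ k ] k ≤ length w × T ≡ codes (take k w)) (codes v ∷ Ts)) eq
         ((length (u ++ new) , ℕ.≤-trans (ℕ.m≤m+n _ _) (ℕ.≤-reflexive (sym (length-++ (u ++ new)))) ,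
           trans (⊆-antisym (codes-⊆ {xs = v} u∪⊇) (codes-⊆ {xs = u ++ new} u∪⊆))
             (cong codes (sym (take-length-++ (u ++ new) z)))) ∷ ls)
    where
    new? = λ x → ¬? (x ∈? u)
    new = filter new? v
    new⁻ : ∀ {x} → x ∈ new → x ∈ v × x ∉ u
    new⁻ = ∈-filter⁻ new? {xs = v}
    u⊆v : ∀ {x} → x ∈ u → x ∈ v
    u⊆v = codes-⊆⁻ {xs = u} s
    u∪⊆ : ∀ {x} → x ∈ u ++ new → x ∈ v
    u∪⊆ m with ∈-++⁻ u m
    ... | inj₁ m′ = u⊆v m′
    ... | inj₂ m′ = proj₁ (new⁻ m′)
    u∪⊇ : ∀ {x} → x ∈ v → x ∈ u ++ new
    u∪⊇ {x} m with x ∈? u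
    ... | yes i = ∈-++⁺ˡ i
    ... | no ¬i = ∈-++⁺ʳ u (∈-filter⁺ new? m ¬i)
    later : ∀ {T′} → codes v ⊂ T′ → codes (u ++ new) ⊆ˢ T′
    later (i , _) m = i (codes-⊆ {xs = u ++ new} u∪⊆ m)
    c′ : Clique S (u ++ new)
    c′ = allPairs⇒clique {S = S} (u ++ new) (clique⇒⊆ v cv ∘ u∪⊆)
      (AllPairs.++⁺ (clique⇒allPairs u c) (AllPairs.filter⁺ new? (clique⇒allPairs v cv))
        (All.tabulate λ m → All.tabulate λ m′ → let i , ∉u = new⁻ m′ in
          clique-adjacent cv (u⊆v m) i λ { refl → ∉u m }))

  clique-length : ∀ d {W S w} → Good d W S → Clique S w → length w ≤ d
  clique-length d       {w = []}    g       _       = z≤n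
  clique-length zero    {w = b ∷ w} (e , _) (s , _) = ⊥-elim (e b s)
  clique-length (suc d) {w = b ∷ w} g       (s , c) = s≤s (clique-length d (proj₂ (good-link d g s)) c)

  module _ {D : ℕ} (g : Good D ∅ S) where

    open Enumeration (enumerate D g)

    clique∈ : ∀ {w} → w ∈ words → Clique S w
    clique∈ m = proj₂ (sound m)

    face⊆flag : ∀ {F} → Face (sd (sd K)) F → ∃[ w ] w ∈ words × F ⊆ˢ flag w
    face⊆flag (Ts , (fs , l) , refl) =
      let z , cz , ls = chain⇒word Ts [] fs (Linked.Linked⇒AllPairs ⊂-trans l) tt (All.universal ⊥⊆′ Ts)
          u , len , cu = extend D z g (clique-length D g cz) cz
      in z ++ u , complete len cu , codes-⊆ {xs = Ts} λ m →
           level z u (proj₂ (All.lookup fs m)) (All.lookup ls m)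
      where
      ⊥⊆′ : ∀ T → codes {n} [] ⊆ˢ T
      ⊥⊆′ T = ⊥⊆
      take-++ : ∀ {A : Set} k (z u : List A) → k ≤ length z → take k (z ++ u) ≡ take k z
      take-++ zero    z       u _        = refl
      take-++ (suc k) (x ∷ z) u (s≤s le) = cong (x ∷_) (take-++ k z u le)
      level : ∀ (z u : List (Subset n)) {T : Subset (2 ^ n)} → Nonempty T →
        ∃[ k ] k ≤ length z × T ≡ codes (take k z) → T ∈ levels (z ++ u)
      level z u (v , v∈) (zero , _ , refl) = ⊥-elim (∉⊥ {2 ^ n} v∈)
      level z u ne (suc k , le , refl) = subst (λ w → codes w ∈ levels (z ++ u)) (take-++ (suc k) z u le)
        (∈-applyUpTo⁺ _ (ℕ.<-≤-trans le (ℕ.≤-trans (ℕ.m≤m+n _ _) (ℕ.≤-reflexive (sym (length-++ z))))))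

    ∣flag∣≡D : ∀ {w} → w ∈ words → ∣ flag w ∣ ≡ D
    ∣flag∣≡D m = trans (∣flag∣ (clique∈ m)) (proj₁ (sound m))

    flag-facet : ∀ {w} → w ∈ words → Facet (sd (sd K)) (flag w)
    flag-facet m = flag-face (clique∈ m) , λ τ τ∈ s → let w′ , m′ , s′ = face⊆flag τ∈ in
      ⊆∧∣∣≤⇒≡ s (ℕ.≤-trans (p⊆q⇒∣p∣≤∣q∣ s′) (ℕ.≤-reflexive (trans (∣flag∣≡D m′) (sym (∣flag∣≡D m)))))

    facet-flag : ∀ {F} → Facet (sd (sd K)) F → ∃[ w ] w ∈ words × F ≡ flag w
    facet-flag (F∈ , mx) = let w , m , s = face⊆flag F∈ in w , m , mx (flag w) (flag-face (clique∈ m)) s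

    -- The index `k` singles out one member of the flag of `q`. The flag of `r` contains all the
    -- others, and the flag of `p` lacks this member as well, so no common face of the two is lost.
    separate : ∀ {P Q} → Before (map flag words) P Q →
      ∃[ R ] Before (map flag words) R Q × P ∩ˢ Q ⊆ˢ R × suc ∣ R ∩ˢ Q ∣ ≡ D
    separate b with before-map⁻ flag words b
    ... | p , q , refl , refl , b′ with separating b′
    ...   | r , b″ , k , k< , np , nr , agree =
      flag r , before-map⁺ flag b″ ,
      (λ {x} m → let mp , mq = x∈p∩q⁻ (flag p) (flag q) m in
        others mq λ { refl → np (∈-flag⇒take-≈ cp cq k<q mp) }) ,
      trans (cong (suc ∘ ∣_∣) cut) (trans (sym (∣-∣ top)) (∣flag∣≡D q∈))
      where
      q∈ = before⇒∈ʳ b′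
      r∈ = before⇒∈ˡ b″
      cp = clique∈ (before⇒∈ˡ b′)
      cq = clique∈ q∈
      cr = clique∈ r∈
      k<q : k < length q
      k<q = subst (k <_) (sym (proj₁ (sound q∈))) k<
      Tₖ = code (codes (take (suc k) q))
      top : Tₖ ∈ˢ flag q
      top = take-≈⇒∈-flag {q} {q} k<q ≐-refl
      others : ∀ {x} → x ∈ˢ flag q → x ≢ Tₖ → x ∈ˢ flag r
      others m ne with ∈-flag⁻ {q} m
      ... | j , j< , refl = take-≈⇒∈-flag {r} {q}
        (subst (j <_) (trans (proj₁ (sound q∈)) (sym (proj₁ (sound r∈)))) j<)
        (agree (suc j) (subst (suc j ≤_) (proj₁ (sound q∈)) j<) λ { refl → ne refl })
      cut : flag r ∩ˢ flag q ≡ flag q - Tₖ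
      cut = ⊆-antisym
        (λ m → let mr , mq = x∈p∩q⁻ (flag r) (flag q) m in
          x∈p∧x≢y⇒x∈p-y mq λ { refl → nr (∈-flag⇒take-≈ cr cq k<q mr) })
        (λ m → let mq = p─q⊆p (flag q) ⁅ Tₖ ⁆ m in
          x∈p∩q⁺ (others mq (λ { refl → ∉-- {p = flag q} m }) , mq))

    sd²-shellable : Shellable (sd (sd K))
    sd²-shellable =
      (λ σ τ f f′ → trans (facet-dim f) (sym (facet-dim f′))) ,
      ℤ.+ D ℤ.- ℤ.1ℤ ,
      ((let u , len , c = fill D g in flag u , flag-face c , cong (λ m → ℤ.+ m ℤ.- ℤ.1ℤ) (∣flag∣≡D (complete len c))) ,
       λ σ σ∈ → let w , m , s = face⊆flag σ∈ in dim-mono-≤ (ℕ.≤-trans (p⊆q⇒∣p∣≤∣q∣ s) (ℕ.≤-reflexive (∣flag∣≡D m)))) ,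
      map flag words ,
      isShelling
        (λ F m → let w , w∈ , e = ∈-map⁻ flag m in subst (Facet (sd (sd K))) (sym e) (flag-facet w∈))
        (λ F f → let w , w∈ , e = facet-flag f in subst (_∈ map flag words) (sym e) (∈-map⁺ flag w∈))
        (λ m → let w , w∈ , e = ∈-map⁻ flag m in trans (cong ∣_∣ e) (∣flag∣≡D w∈))
        separate
      where
      facet-dim : ∀ {σ} → Facet (sd (sd K)) σ → dim σ ≡ ℤ.+ D ℤ.- ℤ.1ℤ
      facet-dim f = let w , m , e = facet-flag f in cong (λ m → ℤ.+ m ℤ.- ℤ.1ℤ) (trans (cong ∣_∣ e) (∣flag∣≡D m))

theorem1 : ∀ (n : ℕ) (K : Complex n) (d : ℤ) → Pure K → HasDimension K d → HRC K → Shellable (sd (sd K))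
-- The face `σ` has largest size, so `D` is its size. The whole complex is the link of the empty
-- face, whose corank is again that size.
theorem1 n K d pure ((σ , σ∈ , refl) , top) hrc = Flags.sd²-shellable K
  (proj₁ (Links.links K bound enlarge hrc (suc ∣ σ ∣) ∣ σ ∣ ℕ.≤-refl (⊆-closed K ⊥⊆ σ∈) (cong (_+ ∣ σ ∣) (∣⊥∣≡0 n))))
  where
  bound : ∀ {τ} → Face K τ → ∣ τ ∣ ≤ ∣ σ ∣
  bound τ∈ = dim-cancel-≤ (top _ τ∈)
  enlarge : ∀ {τ} → Face K τ → ∣ τ ∣ < ∣ σ ∣ → ∃[ ρ ] τ ⊂ ρ × Face K ρ
  enlarge {τ} τ∈ lt with anySubset? (λ ρ → (τ ⊂? ρ) ×-dec face? K ρ)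
  ... | yes e = e
  -- A face with no proper superface is a facet, and purity gives it the size of `σ`.
  ... | no ¬e = ⊥-elim (ℕ.<-irrefl (dim-cancel (pure τ σ (τ∈ , maximal) (σ∈ , λ ρ ρ∈ s → ⊆∧∣∣≤⇒≡ s (bound ρ∈)))) lt)
    where
    maximal : ∀ ρ → Face K ρ → τ ⊆ˢ ρ → τ ≡ ρ
    maximal ρ ρ∈ s with ⊆⇒≡⊎⊂ s
    ... | inj₁ e  = e
    ... | inj₂ s′ = ⊥-elim (¬e (ρ , s′ , ρ∈))
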